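{- Fix $\beta\in(0,1/2)$, an integer $T\ge2$, $p^*\in(0,1)$, $\varepsilon_1>0$ and $\varepsilon>2\varepsilon_1$. Write $\theta_G=\varepsilon-2\varepsilon_1$ and suppose $\beta\le(1-e^{ -\theta_G})/2$. Consider the maximum-selection algorithm with random dropping (described in the context) applied to $T$ mechanisms with range $\{ -1,+1\}$, of which $G\in\{1,\dots,T-2\}$ have success probability $p_t\ge p^*$ and the remaining $T-G$ have success probability $p_t\le\bar p$. Suppose the selection rule is uniform random among all $(+1,t)$ in $S$. If the probability that the algorithm returns $(+1,t)$ with $p_t\le\bar p$ is at most $\beta$, then $$\bar p\le\frac{2\beta(1+Gp^*)}{(T-G)(1-e^{ -\theta_G})}.$$ In particular, for any fixed $\varepsilon>2\varepsilon_1$, $\bar p=O(\beta(1+Gp^*)/(T-G))$.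
   Context: Each input mechanism $\mathcal M_t$ ($t=1,\dots,T$) is a randomized map from datasets to $\{ -1,+1\}$ that is $\varepsilon_1$-DP: $\Pr[\mathcal M_t(X)=v]\le e^{\varepsilon_1}\Pr[\mathcal M_t(X')=v]$ for all neighboring datasets $X,X'$ and $v\in\{ -1,+1\}$. The success probability of $\mathcal M_t$ on the input dataset $X$ is $p_t=\Pr[\mathcal M_t(X)=+1]$. Maximum selection with random dropping. Start with $S=\{\perp\}$. Draw $k\in\{0,1,2,\dots\}$ from the geometric distribution $\mathrm{Geo}(e^{ -\theta_G})$, meaning $\Pr[k\ge j]=e^{ -\theta_Gj}$ for all integers $j\ge0$ (so $\Pr[k=0]=1-e^{ -\theta_G}$). For $t=1,\dots,T$: draw $y_t\sim\mathrm{Bernoulli}(e^{ -\varepsilon_1k})$ independently; if $y_t=1$, draw $o\leftarrow\mathcal M_t(X)$ (independently) and add $(o,t)$ to $S$. Return an element of $S$ chosen by a data-independent selection rule; here, whenever $S$ contains elements of the form $(+1,t)$, one of them is returned uniformly at random.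
   Formalization: The bound β on the probability is assumed for all families of ε₁-DP mechanisms with G fixed positions having p_t ≥ p* and the rest p_t ≤ p̄; for one fixed family the claim fails (every bad p_t = 0, p̄ = 1, small β). Also p̄ is taken in [0,1]. -}

module Defs where

open import Data.Bool.Base using (Bool; true; false; if_then_else_)
open import Data.Fin.Base using (Fin)
open import Data.Fin.Subset using (Subset)
import Data.Fin.Subset as Subset
open import Data.Integer.Base as ℤ using (ℤ) hiding (module ℤ)
open import Data.List.Base as List using (List; []; _∷_; concatMap; filterᵇ; allFin)
open import Data.List.Membership.Propositional using (_∈_)
open import Data.List.Relation.Unary.All using (All)
open import Data.Maybe.Base using (Maybe; just; nothing)
open import Data.Nat.Base as ℕ using (ℕ; zero; suc)
import Data.Nat.Properties as ℕₚ
open import Data.Product.Base using (Σ-syntax; ∃; _×_; _,_; proj₁; proj₂)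
open import Data.Rational.Base as ℚ using (ℚ; 0ℚ; 1ℚ) hiding (module ℚ)
import Data.Rational.Properties as ℚₚ
open import Data.Rational.Solver using (module +-*-Solver)
import Data.Rational.Unnormalised.Base as ℚᵘ
import Data.Rational.Unnormalised.Properties as ℚᵘₚ
import Data.Integer.Properties as ℤₚ
open import Data.Sign.Base as Sign using (Sign)
import Data.Sign.Properties as Signₚ
open import Data.Sum.Base using (inj₁; inj₂; [_,_]′)
open import Algebra.Bundles using (CommutativeRing)
open import Relation.Binary.PropositionalEquality
  using (_≡_; refl; sym; trans; cong; cong₂; subst; subst₂)
open import Relation.Nullary using (Dec; does; yes; no; contradiction)

module RationalLemmas where

  open ℚ using (_+_; _*_; -_; _-_; _≤_; _<_; ∣_∣; 1/_)
  open ℚₚ.≤-Reasoning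
  open +-*-Solver using (solve; _:+_; _:*_; :-_; _:-_; _:=_; con)
  open import Algebra.Properties.CommutativeSemiring.Exp
    (CommutativeRing.commutativeSemiring ℚₚ.+-*-commutativeRing) public
    using (_^_; ^-distrib-*; ^-assocʳ)

  ι : ℕ → ℚ
  ι n = ℤ.+ n ℚ./ 1

  1/suc : ℕ → ℚ
  1/suc n = ℤ.+ 1 ℚ./ suc n

  ι-suc : ∀ n → ι (suc n) ≡ 1ℚ + ι n
  ι-suc n = ℚₚ.toℚᵘ-injective (ℚᵘₚ.≃-trans (ℚₚ.toℚᵘ-fromℚᵘ (ℚᵘ.mkℚᵘ (ℤ.+ suc n) 0))
    (ℚᵘₚ.≃-trans (ℚᵘ.*≡* (cong (ℤ._* ℤ.+ 1) (cong (λ z → ℤ.+ 1 ℤ.+ z) (sym (ℤₚ.*-identityʳ (ℤ.+ n))))))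
    (ℚᵘₚ.≃-sym (ℚᵘₚ.≃-trans (ℚₚ.toℚᵘ-homo-+ 1ℚ (ι n))
      (ℚᵘₚ.+-congʳ ℚᵘ.1ℚᵘ (ℚₚ.toℚᵘ-fromℚᵘ (ℚᵘ.mkℚᵘ (ℤ.+ n) 0)))))))

  ι-* : ∀ m n → ι (m ℕ.* n) ≡ ι m * ι n
  ι-* m n = ℚₚ.toℚᵘ-injective (ℚᵘₚ.≃-trans (ℚₚ.toℚᵘ-fromℚᵘ (ℚᵘ.mkℚᵘ (ℤ.+ (m ℕ.* n)) 0))
    (ℚᵘₚ.≃-trans (ℚᵘ.*≡* (cong (ℤ._* ℤ.+ 1) (ℤₚ.pos-* m n)))
    (ℚᵘₚ.≃-sym (ℚᵘₚ.≃-trans (ℚₚ.toℚᵘ-homo-* (ι m) (ι n))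
      (ℚᵘₚ.*-cong (ℚₚ.toℚᵘ-fromℚᵘ (ℚᵘ.mkℚᵘ (ℤ.+ m) 0)) (ℚₚ.toℚᵘ-fromℚᵘ (ℚᵘ.mkℚᵘ (ℤ.+ n) 0)))))))

  ι*1/suc : ∀ n → ι (suc n) * 1/suc n ≡ 1ℚ
  ι*1/suc n = ℚₚ.toℚᵘ-injective (ℚᵘₚ.≃-trans (ℚₚ.toℚᵘ-homo-* (ι (suc n)) (1/suc n))
    (ℚᵘₚ.≃-trans (ℚᵘₚ.*-cong (ℚₚ.toℚᵘ-fromℚᵘ (ℚᵘ.mkℚᵘ (ℤ.+ suc n) 0)) (ℚₚ.toℚᵘ-fromℚᵘ (ℚᵘ.mkℚᵘ (ℤ.+ 1) n)))
    (ℚᵘ.*≡* (cong ℤ.+_ (trans (ℕₚ.*-identityʳ (suc n ℕ.* 1)) (trans (ℕₚ.*-identityʳ (suc n))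
      (sym (trans (ℕₚ.*-identityˡ (1 ℕ.* suc n)) (ℕₚ.*-identityˡ (suc n))))))))))

  0≤ι : ∀ n → 0ℚ ≤ ι n
  0≤ι n = ℚₚ.nonNegative⁻¹ (ι n) {{ℚₚ.normalize-nonNeg n 1}}

  0<ι : ∀ n → 0ℚ < ι (suc n)
  0<ι n = ℚₚ.positive⁻¹ (ι (suc n)) {{ℚₚ.normalize-pos (suc n) 1}}

  0≤1/suc : ∀ n → 0ℚ ≤ 1/suc n
  0≤1/suc n = ℚₚ.nonNegative⁻¹ (1/suc n) {{ℚₚ.normalize-nonNeg 1 (suc n)}}

  0≤1 : 0ℚ ≤ 1ℚ
  0≤1 = 0≤ι 1

  0<½ : 0ℚ < ℚ.½
  0<½ = ℚₚ.positive⁻¹ ℚ.½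

  *-monoˡ : ∀ {r p q} → 0ℚ ≤ r → p ≤ q → r * p ≤ r * q
  *-monoˡ {r} 0≤r = ℚₚ.*-monoˡ-≤-nonNeg r {{ℚ.nonNegative 0≤r}}

  *-monoʳ : ∀ {r p q} → 0ℚ ≤ r → p ≤ q → p * r ≤ q * r
  *-monoʳ {r} 0≤r = ℚₚ.*-monoʳ-≤-nonNeg r {{ℚ.nonNegative 0≤r}}

  *-mono : ∀ {a b c d} → 0ℚ ≤ a → a ≤ b → 0ℚ ≤ c → c ≤ d → a * c ≤ b * d
  *-mono 0≤a a≤b 0≤c c≤d = ℚₚ.≤-trans (*-monoʳ 0≤c a≤b) (*-monoˡ (ℚₚ.≤-trans 0≤a a≤b) c≤d)

  0≤* : ∀ {p q} → 0ℚ ≤ p → 0ℚ ≤ q → 0ℚ ≤ p * q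
  0≤* {p} {q} 0≤p 0≤q = ℚₚ.≤-trans (ℚₚ.≤-reflexive (sym (ℚₚ.*-zeroʳ p))) (*-monoˡ 0≤p 0≤q)

  0<* : ∀ {p q} → 0ℚ < p → 0ℚ < q → 0ℚ < p * q
  0<* {p} {q} 0<p 0<q = ℚₚ.positive⁻¹ (p * q)
    {{ℚₚ.pos*pos⇒pos p {{ℚ.positive 0<p}} q {{ℚ.positive 0<q}}}}

  0≤+ : ∀ {p q} → 0ℚ ≤ p → 0ℚ ≤ q → 0ℚ ≤ p + q
  0≤+ 0≤p 0≤q = ℚₚ.+-mono-≤ 0≤p 0≤q

  0<+ : ∀ {p q} → 0ℚ ≤ p → 0ℚ < q → 0ℚ < p + q
  0<+ 0≤p 0<q = ℚₚ.+-mono-≤-< 0≤p 0<q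

  ≤⇒0≤- : ∀ {p q} → p ≤ q → 0ℚ ≤ q - p
  ≤⇒0≤- {p} {q} p≤q = ℚₚ.≤-trans (ℚₚ.≤-reflexive (sym (ℚₚ.+-inverseʳ p))) (ℚₚ.+-monoˡ-≤ (- p) p≤q)

  0≤-⇒≤ : ∀ {p q} → 0ℚ ≤ q - p → p ≤ q
  0≤-⇒≤ {p} {q} h = begin
    p            ≡⟨ solve 1 (λ p → p := con 0ℚ :+ p) refl p ⟩
    0ℚ + p       ≤⟨ ℚₚ.+-monoˡ-≤ p h ⟩
    (q - p) + p  ≡⟨ solve 2 (λ q p → (q :- p) :+ p := q) refl q p ⟩
    q            ∎

  p≤∣p∣ : ∀ p → p ≤ ∣ p ∣
  p≤∣p∣ p with ℚₚ.≤-total 0ℚ p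
  ... | inj₁ 0≤p = ℚₚ.≤-reflexive (sym (ℚₚ.0≤p⇒∣p∣≡p 0≤p))
  ... | inj₂ p≤0 = ℚₚ.≤-trans p≤0 (ℚₚ.0≤∣p∣ p)

  ∣-∣-≤ : ∀ {p q} → p ≤ q → - p ≤ q → ∣ p ∣ ≤ q
  ∣-∣-≤ {p} {q} p≤q -p≤q with ℚₚ.∣p∣≡p∨∣p∣≡-p p
  ... | inj₁ e = subst (_≤ q) (sym e) p≤q
  ... | inj₂ e = subst (_≤ q) (sym e) -p≤q

  ∣p-q∣≡∣q-p∣ : ∀ p q → ∣ p - q ∣ ≡ ∣ q - p ∣
  ∣p-q∣≡∣q-p∣ p q = trans (cong ∣_∣ (solve 2 (λ p q → p :- q := :- (q :- p)) refl p q)) (ℚₚ.∣-p∣≡∣p∣ (q - p))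

  ∣-∣-sym-≤ : ∀ {p q r} → p ≤ q → q - p ≤ r → ∣ p - q ∣ ≤ r
  ∣-∣-sym-≤ {p} {q} {r} p≤q h = subst (_≤ r)
    (trans (sym (ℚₚ.0≤p⇒∣p∣≡p (≤⇒0≤- p≤q))) (∣p-q∣≡∣q-p∣ q p)) h

  triangle : ∀ p q r → ∣ p - r ∣ ≤ ∣ p - q ∣ + ∣ q - r ∣
  triangle p q r = begin
    ∣ p - r ∣              ≡⟨ cong ∣_∣ (solve 3 (λ p q r → p :- r := (p :- q) :+ (q :- r)) refl p q r) ⟩
    ∣ (p - q) + (q - r) ∣  ≤⟨ ℚₚ.∣p+q∣≤∣p∣+∣q∣ (p - q) (q - r) ⟩
    ∣ p - q ∣ + ∣ q - r ∣  ∎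

  half-sum : ∀ ε → ε * ℚ.½ + ε * ℚ.½ ≡ ε
  half-sum ε = solve 1 (λ e → e :* con ℚ.½ :+ e :* con ℚ.½ := e) refl ε

  0<half : ∀ {ε} → 0ℚ < ε → 0ℚ < ε * ℚ.½
  0<half 0<ε = 0<* 0<ε 0<½

  ι-mono : ∀ {m n} → m ℕ.≤ n → ι m ≤ ι n
  ι-mono {m} {n} (ℕ.z≤n) = 0≤ι n
  ι-mono {suc m} {suc n} (ℕ.s≤s le) = subst₂ _≤_ (sym (ι-suc m)) (sym (ι-suc n)) (ℚₚ.+-monoʳ-≤ 1ℚ (ι-mono le))

  archimedean : ∀ q → Σ[ n ∈ ℕ ] q ≤ ι n
  archimedean q@(ℚ.mkℚ n d c) = ℤ.∣ n ∣ , ℚₚ.toℚᵘ-cancel-≤ (ℚᵘₚ.≤-trans lem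
      (ℚᵘₚ.≤-reflexive (ℚᵘₚ.≃-sym (ℚₚ.toℚᵘ-fromℚᵘ (ℚᵘ.mkℚᵘ (ℤ.+ ℤ.∣ n ∣) 0)))))
    where
    bound : ∀ n → n ℤ.* ℤ.+ 1 ℤ.≤ ℤ.+ ℤ.∣ n ∣ ℤ.* ℤ.+ suc d
    bound (ℤ.+ k) = subst₂ ℤ._≤_ (ℤₚ.pos-* k 1) (ℤₚ.pos-* k (suc d))
      (ℤ.+≤+ (ℕₚ.*-monoʳ-≤ k (ℕ.s≤s ℕ.z≤n)))
    bound (ℤ.-[1+ k ]) = ℤ.-≤+
    lem : ℚ.toℚᵘ q ℚᵘ.≤ ℚᵘ.mkℚᵘ (ℤ.+ ℤ.∣ n ∣) 0
    lem = ℚᵘ.*≤* (bound n)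

  -- recip 0ℚ is set to 0ℚ.
  recip : ℚ → ℚ
  recip q with q ℚₚ.≟ 0ℚ
  ... | yes _  = 0ℚ
  ... | no q≢0 = (1/ q) {{ℚ.≢-nonZero q≢0}}

  recip-inverse : ∀ {q} → 0ℚ < q → q * recip q ≡ 1ℚ
  recip-inverse {q} 0<q with q ℚₚ.≟ 0ℚ
  ... | yes q≡0 = contradiction (sym q≡0) (ℚₚ.<⇒≢ 0<q)
  ... | no q≢0  = ℚₚ.*-inverseʳ q {{ℚ.≢-nonZero q≢0}}

  0<recip : ∀ {q} → 0ℚ < q → 0ℚ < recip q
  0<recip {q} 0<q with q ℚₚ.≟ 0ℚ
  ... | yes q≡0 = contradiction (sym q≡0) (ℚₚ.<⇒≢ 0<q)
  ... | no q≢0  = ℚₚ.positive⁻¹ _ {{ℚₚ.1/pos⇒pos q {{ℚ.positive 0<q}}}}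

  *-cancel-≤ : ∀ {r p q} → 0ℚ < r → r * p ≤ r * q → p ≤ q
  *-cancel-≤ {r} 0<r = ℚₚ.*-cancelˡ-≤-pos r {{ℚ.positive 0<r}}

  recip-anti : ∀ {p q} → 0ℚ < p → p ≤ q → recip q ≤ recip p
  recip-anti {p} {q} 0<p p≤q = *-cancel-≤ 0<p (*-cancel-≤ 0<q (begin
    q * (p * recip q)  ≡⟨ solve 3 (λ q p r → q :* (p :* r) := (q :* r) :* p) refl q p (recip q) ⟩
    (q * recip q) * p  ≡⟨ cong (_* p) (recip-inverse 0<q) ⟩
    1ℚ * p             ≡⟨ ℚₚ.*-identityˡ p ⟩
    p                  ≤⟨ p≤q ⟩
    q                  ≡⟨ ℚₚ.*-identityʳ q ⟨
    q * 1ℚ             ≡⟨ cong (q *_) (recip-inverse 0<p) ⟨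
    q * (p * recip p)  ∎))
    where 0<q = ℚₚ.<-≤-trans 0<p p≤q

  small-1/suc : ∀ {D ε} → 0ℚ ≤ D → 0ℚ < ε → Σ[ N ∈ ℕ ] (∀ n → N ℕ.≤ n → D * 1/suc n ≤ ε)
  small-1/suc {D} {ε} 0≤D 0<ε with archimedean (D * recip ε)
  ... | N , h = N , λ n N≤n → *-cancel-≤ (0<ι n) (begin
    ι (suc n) * (D * 1/suc n)  ≡⟨ solve 3 (λ i D u → i :* (D :* u) := D :* (i :* u)) refl (ι (suc n)) D (1/suc n) ⟩
    D * (ι (suc n) * 1/suc n)  ≡⟨ cong (D *_) (trans (ι*1/suc n) (sym (recip-inverse 0<ε))) ⟩
    D * (ε * recip ε)          ≡⟨ solve 3 (λ D e r → D :* (e :* r) := (D :* r) :* e) refl D ε (recip ε) ⟩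
    (D * recip ε) * ε          ≤⟨ *-monoʳ (ℚₚ.<⇒≤ 0<ε) (ℚₚ.≤-trans h (ι-mono (ℕₚ.≤-trans N≤n (ℕₚ.n≤1+n n)))) ⟩
    ι (suc n) * ε              ∎)

  0≤^ : ∀ {p} n → 0ℚ ≤ p → 0ℚ ≤ p ^ n
  0≤^ zero    0≤p = 0≤1
  0≤^ (suc n) 0≤p = 0≤* 0≤p (0≤^ n 0≤p)

  ^-mono : ∀ {p q} n → 0ℚ ≤ p → p ≤ q → p ^ n ≤ q ^ n
  ^-mono zero    0≤p p≤q = ℚₚ.≤-refl
  ^-mono (suc n) 0≤p p≤q = *-mono 0≤p p≤q (0≤^ n 0≤p) (^-mono n 0≤p p≤q)

  1^n : ∀ n → 1ℚ ^ n ≡ 1ℚ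
  1^n zero    = refl
  1^n (suc n) = trans (ℚₚ.*-identityˡ _) (1^n n)

  0≤sq : ∀ p → 0ℚ ≤ p * p
  0≤sq p with ℚₚ.≤-total 0ℚ p
  ... | inj₁ 0≤p = 0≤* 0≤p 0≤p
  ... | inj₂ p≤0 = subst (0ℚ ≤_) (solve 1 (λ p → (:- p) :* (:- p) := p :* p) refl p)
                     (0≤* (ℚₚ.neg-antimono-≤ p≤0) (ℚₚ.neg-antimono-≤ p≤0))

  bernoulli-inequality : ∀ n {w} → 0ℚ ≤ 1ℚ + w → 1ℚ + ι n * w ≤ (1ℚ + w) ^ n
  bernoulli-inequality zero {w} _ = ℚₚ.≤-reflexive (solve 1 (λ w → con 1ℚ :+ con 0ℚ :* w := con 1ℚ) refl w)
  bernoulli-inequality (suc n) {w} h = begin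
    1ℚ + ι (suc n) * w                     ≡⟨ cong (λ i → 1ℚ + i * w) (ι-suc n) ⟩
    1ℚ + (1ℚ + ι n) * w                    ≡⟨ ℚₚ.+-identityʳ _ ⟨
    1ℚ + (1ℚ + ι n) * w + 0ℚ               ≤⟨ ℚₚ.+-monoʳ-≤ (1ℚ + (1ℚ + ι n) * w) (0≤* (0≤ι n) (0≤sq w)) ⟩
    1ℚ + (1ℚ + ι n) * w + ι n * (w * w)    ≡⟨ solve 2 (λ i w → con 1ℚ :+ (con 1ℚ :+ i) :* w :+ i :* (w :* w)
                                                := (con 1ℚ :+ w) :* (con 1ℚ :+ i :* w)) refl (ι n) w ⟩
    (1ℚ + w) * (1ℚ + ι n * w)              ≤⟨ *-monoˡ h (bernoulli-inequality n h) ⟩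
    (1ℚ + w) * (1ℚ + w) ^ n                ∎

  -- (1+w)^n (1-w)^n = (1-w²)^n lies between 1 - n w² and 1.
  paired-≤1 : ∀ n {w} → 0ℚ ≤ 1ℚ + w → 0ℚ ≤ 1ℚ - w → (1ℚ + w) ^ n * (1ℚ - w) ^ n ≤ 1ℚ
  paired-≤1 n {w} h₊ h₋ = begin
    (1ℚ + w) ^ n * (1ℚ - w) ^ n  ≡⟨ ^-distrib-* (1ℚ + w) (1ℚ - w) n ⟨
    ((1ℚ + w) * (1ℚ - w)) ^ n    ≤⟨ ^-mono n (0≤* h₊ h₋) (0≤-⇒≤ (subst (0ℚ ≤_)
                                      (solve 1 (λ w → w :* w := con 1ℚ :- (con 1ℚ :+ w) :* (con 1ℚ :- w)) refl w) (0≤sq w))) ⟩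
    1ℚ ^ n                       ≡⟨ 1^n n ⟩
    1ℚ                           ∎

  paired-≥ : ∀ n {w} → 0ℚ ≤ 1ℚ + w → 0ℚ ≤ 1ℚ - w →
             1ℚ - ι n * (w * w) ≤ (1ℚ + w) ^ n * (1ℚ - w) ^ n
  paired-≥ n {w} h₊ h₋ = begin
    1ℚ - ι n * (w * w)           ≡⟨ solve 2 (λ i w → con 1ℚ :- i :* (w :* w) := con 1ℚ :+ i :* (:- (w :* w))) refl (ι n) w ⟩
    1ℚ + ι n * (- (w * w))       ≤⟨ bernoulli-inequality n (subst (0ℚ ≤_) e (0≤* h₊ h₋)) ⟩
    (1ℚ + - (w * w)) ^ n         ≡⟨ cong (_^ n) (sym e) ⟩
    ((1ℚ + w) * (1ℚ - w)) ^ n    ≡⟨ ^-distrib-* (1ℚ + w) (1ℚ - w) n ⟩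
    (1ℚ + w) ^ n * (1ℚ - w) ^ n  ∎
    where e = solve 1 (λ w → (con 1ℚ :+ w) :* (con 1ℚ :- w) := con 1ℚ :+ (:- (w :* w))) refl w

  -- Passing from the exponent N and step v to the exponent M N and step w = v / M.
  module Refine (M N : ℕ) {v w : ℚ} (v≡Mw : v ≡ ι M * w)
                (0≤1+w : 0ℚ ≤ 1ℚ + w) (0≤1+v : 0ℚ ≤ 1ℚ + v) where

    fine : ℚ
    fine = (1ℚ + w) ^ (M ℕ.* N)

    coarse≤fine : (1ℚ + v) ^ N ≤ fine
    coarse≤fine = begin
      (1ℚ + v) ^ N         ≤⟨ ^-mono N 0≤1+v (subst (λ z → 1ℚ + z ≤ (1ℚ + w) ^ M) (sym v≡Mw) (bernoulli-inequality M 0≤1+w)) ⟩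
      ((1ℚ + w) ^ M) ^ N   ≡⟨ ^-assocʳ (1ℚ + w) M N ⟩
      fine                 ∎

    module _ (0≤1-w : 0ℚ ≤ 1ℚ - w) (0≤1-v : 0ℚ ≤ 1ℚ - v) where

      0≤fine : 0ℚ ≤ fine
      0≤fine = 0≤^ (M ℕ.* N) 0≤1+w

      fine*coarse≤1 : fine * (1ℚ - v) ^ N ≤ 1ℚ
      fine*coarse≤1 = begin
        fine * (1ℚ - v) ^ N                          ≤⟨ *-monoˡ 0≤fine (^-mono N 0≤1-v
          (subst (λ z → z ≤ (1ℚ - w) ^ M)
            (trans (solve 2 (λ i w → con 1ℚ :+ i :* (:- w) := con 1ℚ :- (i :* w)) refl (ι M) w) (cong (λ z → 1ℚ - z) (sym v≡Mw)))
            (bernoulli-inequality M 0≤1-w))) ⟩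
        fine * ((1ℚ - w) ^ M) ^ N                    ≡⟨ cong (fine *_) (^-assocʳ (1ℚ - w) M N) ⟩
        fine * (1ℚ - w) ^ (M ℕ.* N)                  ≤⟨ paired-≤1 (M ℕ.* N) {w} 0≤1+w 0≤1-w ⟩
        1ℚ                                           ∎

      fine-coarse≤ : fine - (1ℚ + v) ^ N ≤ fine * (ι N * (v * v))
      fine-coarse≤ = 0≤-⇒≤ (subst (0ℚ ≤_)
          (solve 3 (λ f c k → c :- f :* (con 1ℚ :- k) := f :* k :- (f :- c)) refl fine ((1ℚ + v) ^ N) (ι N * (v * v)))
          (≤⇒0≤- (begin
            fine * (1ℚ - ι N * (v * v))                  ≤⟨ *-monoˡ 0≤fine (paired-≥ N {v} 0≤1+v 0≤1-v) ⟩
            fine * ((1ℚ + v) ^ N * (1ℚ - v) ^ N)         ≡⟨ solve 3 (λ f a b → f :* (a :* b) := (f :* b) :* a) refl fine ((1ℚ + v) ^ N) ((1ℚ - v) ^ N) ⟩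
            (fine * (1ℚ - v) ^ N) * (1ℚ + v) ^ N         ≤⟨ *-monoʳ (0≤^ N 0≤1+v) fine*coarse≤1 ⟩
            1ℚ * (1ℚ + v) ^ N                            ≡⟨ ℚₚ.*-identityˡ _ ⟩
            (1ℚ + v) ^ N                                 ∎)))

  compound : ℚ → ℕ → ℚ
  compound q n = (1ℚ + q * 1/suc n) ^ suc n

  1/suc-refine : ∀ n m → 1/suc n ≡ ι (suc m) * 1/suc (n ℕ.+ m ℕ.* suc n)
  1/suc-refine n m = ℚₚ.≤-antisym (*-cancel-≤ (0<ι k) (ℚₚ.≤-reflexive e)) (*-cancel-≤ (0<ι k) (ℚₚ.≤-reflexive (sym e)))
    where
    k = n ℕ.+ m ℕ.* suc n
    e : ι (suc k) * 1/suc n ≡ ι (suc k) * (ι (suc m) * 1/suc k)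
    e = begin-equality
      ι (suc k) * 1/suc n                ≡⟨ cong (_* 1/suc n) (ι-* (suc m) (suc n)) ⟩
      (ι (suc m) * ι (suc n)) * 1/suc n  ≡⟨ ℚₚ.*-assoc (ι (suc m)) (ι (suc n)) (1/suc n) ⟩
      ι (suc m) * (ι (suc n) * 1/suc n)  ≡⟨ cong (ι (suc m) *_) (trans (ι*1/suc n) (sym (ι*1/suc k))) ⟩
      ι (suc m) * (ι (suc k) * 1/suc k)  ≡⟨ solve 3 (λ a b c → a :* (b :* c) := b :* (a :* c)) refl (ι (suc m)) (ι (suc k)) (1/suc k) ⟩
      ι (suc k) * (ι (suc m) * 1/suc k)  ∎

  step-refine : ∀ q n m → q * 1/suc n ≡ ι (suc m) * (q * 1/suc (n ℕ.+ m ℕ.* suc n))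
  step-refine q n m = trans (cong (q *_) (1/suc-refine n m))
    (solve 3 (λ q i u → q :* (i :* u) := i :* (q :* u)) refl q (ι (suc m)) (1/suc (n ℕ.+ m ℕ.* suc n)))

  step≤1 : ∀ {q} n → q ≤ ι (suc n) → q * 1/suc n ≤ 1ℚ
  step≤1 n h = ℚₚ.≤-trans (*-monoʳ (0≤1/suc n) h) (ℚₚ.≤-reflexive (ι*1/suc n))

  0≤1-step : ∀ {q} n → q ≤ ι (suc n) → 0ℚ ≤ 1ℚ - q * 1/suc n
  0≤1-step n h = ≤⇒0≤- (step≤1 n h)

  0≤1+step : ∀ {q} n → - q ≤ ι (suc n) → 0ℚ ≤ 1ℚ + q * 1/suc n
  0≤1+step {q} n h = subst (0ℚ ≤_)
    (solve 2 (λ q u → con 1ℚ :- (:- q) :* u := con 1ℚ :+ q :* u) refl q (1/suc n)) (0≤1-step { - q} n h)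

  0≤1+nonNeg : ∀ {q} n → 0ℚ ≤ q → 0ℚ ≤ 1ℚ + q * 1/suc n
  0≤1+nonNeg n 0≤q = 0≤+ 0≤1 (0≤* 0≤q (0≤1/suc n))

  compoundBound : ℕ → ℚ
  compoundBound C = ι 2 ^ (suc C ℕ.+ suc C)

  0≤compoundBound : ∀ C → 0ℚ ≤ compoundBound C
  0≤compoundBound C = 0≤^ (suc C ℕ.+ suc C) (0≤ι 2)

  compound-mono : ∀ {p q} n → - p ≤ ι (suc n) → p ≤ q → compound p n ≤ compound q n
  compound-mono n h p≤q = ^-mono (suc n) (0≤1+step n h) (ℚₚ.+-monoʳ-≤ 1ℚ (*-monoʳ (0≤1/suc n) p≤q))

  compound-ι≤ : ∀ C n → compound (ι (suc C)) n ≤ compoundBound C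
  compound-ι≤ C n = ℚₚ.≤-trans R₁.coarse≤fine (ℚₚ.≤-trans (ℚₚ.≤-reflexive same) R₂≤)
    where
    q = ι (suc C)
    j = C ℕ.+ suc C
    k₁ = n ℕ.+ j ℕ.* suc n
    k₂ = j ℕ.+ n ℕ.* suc j
    k₁≡k₂ : k₁ ≡ k₂
    k₁≡k₂ = ℕₚ.suc-injective (ℕₚ.*-comm (suc j) (suc n))
    q≤ : ∀ k → suc C ℕ.≤ k → q ≤ ι k
    q≤ k = ι-mono
    module R₁ = Refine (suc j) (suc n) {q * 1/suc n} {q * 1/suc k₁} (step-refine q n j)
                  (0≤1+nonNeg k₁ (0≤ι (suc C))) (0≤1+nonNeg n (0≤ι (suc C)))
    module R₂ = Refine (suc n) (suc j) {q * 1/suc j} {q * 1/suc k₂} (step-refine q j n)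
                  (0≤1+nonNeg k₂ (0≤ι (suc C))) (0≤1+nonNeg j (0≤ι (suc C)))
    sC≤sj : suc C ℕ.≤ suc j
    sC≤sj = ℕₚ.m≤m+n (suc C) (suc C)
    0≤1-w : 0ℚ ≤ 1ℚ - q * 1/suc k₂
    0≤1-w = 0≤1-step k₂ (q≤ (suc k₂) (ℕₚ.≤-trans sC≤sj (ℕ.s≤s (ℕₚ.m≤m+n j (n ℕ.* suc j)))))
    0≤1-v : 0ℚ ≤ 1ℚ - q * 1/suc j
    0≤1-v = 0≤1-step j (q≤ (suc j) sC≤sj)
    2q≡ : ι (suc j) ≡ ι 2 * q
    2q≡ = trans (cong ι (cong (suc C ℕ.+_) (sym (ℕₚ.+-identityʳ (suc C))))) (ι-* 2 (suc C))
    2*[1-v]≡1 : ι 2 * (1ℚ - q * 1/suc j) ≡ 1ℚ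
    2*[1-v]≡1 = begin-equality
      ι 2 * (1ℚ - q * 1/suc j)          ≡⟨ solve 3 (λ t q u → t :* (con 1ℚ :- q :* u) := t :- (t :* q) :* u) refl (ι 2) q (1/suc j) ⟩
      ι 2 - (ι 2 * q) * 1/suc j         ≡⟨ cong (λ z → ι 2 - z * 1/suc j) (sym 2q≡) ⟩
      ι 2 - ι (suc j) * 1/suc j         ≡⟨ cong (λ z → ι 2 - z) (ι*1/suc j) ⟩
      ι 2 - 1ℚ                          ≡⟨⟩
      1ℚ                                ∎
    same : R₁.fine ≡ R₂.fine
    same = cong₂ (λ k e → (1ℚ + q * 1/suc k) ^ e) k₁≡k₂ (ℕₚ.*-comm (suc j) (suc n))
    R₂≤ : R₂.fine ≤ compoundBound C
    R₂≤ = begin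
      R₂.fine                                                        ≡⟨ ℚₚ.*-identityʳ _ ⟨
      R₂.fine * 1ℚ                                                   ≡⟨ cong (R₂.fine *_) (trans (cong (_^ suc j) 2*[1-v]≡1) (1^n (suc j))) ⟨
      R₂.fine * (ι 2 * (1ℚ - q * 1/suc j)) ^ suc j                   ≡⟨ cong (R₂.fine *_) (^-distrib-* (ι 2) (1ℚ - q * 1/suc j) (suc j)) ⟩
      R₂.fine * (ι 2 ^ suc j * (1ℚ - q * 1/suc j) ^ suc j)           ≡⟨ solve 3 (λ f a b → f :* (a :* b) := (f :* b) :* a) refl R₂.fine (ι 2 ^ suc j) ((1ℚ - q * 1/suc j) ^ suc j) ⟩
      (R₂.fine * (1ℚ - q * 1/suc j) ^ suc j) * ι 2 ^ suc j           ≤⟨ *-monoʳ (0≤compoundBound C) (R₂.fine*coarse≤1 0≤1-w 0≤1-v) ⟩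
      1ℚ * ι 2 ^ suc j                                               ≡⟨ ℚₚ.*-identityˡ _ ⟩
      compoundBound C                                                ∎

  module Bounded (C : ℕ) where

    InRange : ℚ → Set
    InRange q = q ≤ ι (suc C) × - q ≤ ι (suc C)

    compound≤ : ∀ {q} n → InRange q → C ℕ.≤ n → compound q n ≤ compoundBound C
    compound≤ n (h , h′) C≤n = ℚₚ.≤-trans
      (compound-mono n (ℚₚ.≤-trans h′ (ι-mono (ℕ.s≤s C≤n))) h) (compound-ι≤ C n)

    errorConstant : ℚ
    errorConstant = compoundBound C * (ι (suc C) * ι (suc C))

    0≤errorConstant : 0ℚ ≤ errorConstant
    0≤errorConstant = 0≤* (0≤compoundBound C) (0≤sq (ι (suc C)))

    sq≤ : ∀ {q} → InRange q → q * q ≤ ι (suc C) * ι (suc C)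
    sq≤ {q} (h , h′) with ℚₚ.≤-total 0ℚ q
    ... | inj₁ 0≤q = *-mono 0≤q h 0≤q h
    ... | inj₂ q≤0 = subst (_≤ ι (suc C) * ι (suc C)) (solve 1 (λ p → (:- p) :* (:- p) := p :* p) refl q)
                       (*-mono (ℚₚ.neg-antimono-≤ q≤0) h′ (ℚₚ.neg-antimono-≤ q≤0) h′)

    refine-error : ∀ {q} n m → InRange q → C ℕ.≤ n →
      compound q n ≤ compound q (n ℕ.+ m ℕ.* suc n) ×
      compound q (n ℕ.+ m ℕ.* suc n) - compound q n ≤ errorConstant * 1/suc n
    refine-error {q} n m r@(h , h′) C≤n = R.coarse≤fine , (begin
        compound q k - compound q n                                            ≤⟨ R.fine-coarse≤ (0≤1-step k (≤k h)) (0≤1-step n (≤n h)) ⟩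
        compound q k * (ι (suc n) * ((q * 1/suc n) * (q * 1/suc n)))           ≡⟨ cong (compound q k *_) (begin-equality
          ι (suc n) * ((q * 1/suc n) * (q * 1/suc n))  ≡⟨ solve 3 (λ i q u → i :* ((q :* u) :* (q :* u)) := (i :* u) :* ((q :* q) :* u)) refl (ι (suc n)) q (1/suc n) ⟩
          (ι (suc n) * 1/suc n) * ((q * q) * 1/suc n)  ≡⟨ cong (_* ((q * q) * 1/suc n)) (ι*1/suc n) ⟩
          1ℚ * ((q * q) * 1/suc n)                     ≡⟨ ℚₚ.*-identityˡ _ ⟩
          (q * q) * 1/suc n                            ∎) ⟩
        compound q k * ((q * q) * 1/suc n)                                     ≤⟨ *-mono (R.0≤fine (0≤1-step k (≤k h)) (0≤1-step n (≤n h))) (compound≤ k r (ℕₚ.≤-trans C≤n n≤k))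
                                                                                    (0≤* (0≤sq q) (0≤1/suc n)) (*-monoʳ (0≤1/suc n) (sq≤ r)) ⟩
        compoundBound C * ((ι (suc C) * ι (suc C)) * 1/suc n)                  ≡⟨ sym (ℚₚ.*-assoc (compoundBound C) (ι (suc C) * ι (suc C)) (1/suc n)) ⟩
        errorConstant * 1/suc n                                                ∎)
      where
      k = n ℕ.+ m ℕ.* suc n
      n≤k : n ℕ.≤ k
      n≤k = ℕₚ.m≤m+n n (m ℕ.* suc n)
      ≤n : ∀ {p} → p ≤ ι (suc C) → p ≤ ι (suc n)
      ≤n g = ℚₚ.≤-trans g (ι-mono (ℕ.s≤s C≤n))
      ≤k : ∀ {p} → p ≤ ι (suc C) → p ≤ ι (suc k)
      ≤k g = ℚₚ.≤-trans (≤n g) (ι-mono (ℕ.s≤s n≤k))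
      module R = Refine (suc m) (suc n) {q * 1/suc n} {q * 1/suc k} (step-refine q n m)
                   (0≤1+step k (≤k h′)) (0≤1+step n (≤n h′))

    refine-error∣∣ : ∀ {q} n m → InRange q → C ℕ.≤ n →
      ∣ compound q n - compound q (n ℕ.+ m ℕ.* suc n) ∣ ≤ errorConstant * 1/suc n
    refine-error∣∣ {q} n m r C≤n = ∣-∣-sym-≤ (proj₁ e) (proj₂ e)
      where e = refine-error {q} n m r C≤n

    same-point-error : ∀ {q} n m → InRange q → C ℕ.≤ n → C ℕ.≤ m →
      ∣ compound q n - compound q m ∣ ≤ errorConstant * 1/suc n + errorConstant * 1/suc m
    same-point-error {q} n m r C≤n C≤m = begin
      ∣ compound q n - compound q m ∣                                       ≤⟨ triangle (compound q n) (compound q k₁) (compound q m) ⟩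
      ∣ compound q n - compound q k₁ ∣ + ∣ compound q k₁ - compound q m ∣   ≡⟨ cong (∣ compound q n - compound q k₁ ∣ +_)
                                                                                (trans (cong (λ k → ∣ compound q k - compound q m ∣) k₁≡k₂) (∣p-q∣≡∣q-p∣ (compound q k₂) (compound q m))) ⟩
      ∣ compound q n - compound q k₁ ∣ + ∣ compound q m - compound q k₂ ∣   ≤⟨ ℚₚ.+-mono-≤ (refine-error∣∣ n m r C≤n) (refine-error∣∣ m n r C≤m) ⟩
      errorConstant * 1/suc n + errorConstant * 1/suc m                     ∎
      where
      k₁ = n ℕ.+ m ℕ.* suc n
      k₂ = m ℕ.+ n ℕ.* suc m
      k₁≡k₂ : k₁ ≡ k₂
      k₁≡k₂ = ℕₚ.suc-injective (ℕₚ.*-comm (suc m) (suc n))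

    pow-lipschitz : ∀ {a b c} n → 0ℚ ≤ b → b ≤ a → a ≤ c → 1ℚ ≤ c →
      a ^ n - b ^ n ≤ (ι n * (a - b)) * c ^ n
    pow-lipschitz {a} {b} {c} zero 0≤b b≤a a≤c 1≤c = ℚₚ.≤-reflexive
      (solve 2 (λ a b → con 1ℚ :- con 1ℚ := (con 0ℚ :* (a :- b)) :* con 1ℚ) refl a b)
    pow-lipschitz {a} {b} {c} (suc n) 0≤b b≤a a≤c 1≤c = begin
      a * a ^ n - b * b ^ n                                   ≡⟨ solve 4 (λ a b A B → a :* A :- b :* B := a :* (A :- B) :+ (a :- b) :* B) refl a b (a ^ n) (b ^ n) ⟩
      a * (a ^ n - b ^ n) + (a - b) * b ^ n                   ≤⟨ ℚₚ.+-mono-≤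
        (*-mono 0≤a a≤c (≤⇒0≤- (^-mono n 0≤b b≤a)) (pow-lipschitz n 0≤b b≤a a≤c 1≤c))
        (*-monoˡ (≤⇒0≤- b≤a) (ℚₚ.≤-trans (^-mono n 0≤b (ℚₚ.≤-trans b≤a a≤c)) cⁿ≤)) ⟩
      c * ((ι n * (a - b)) * c ^ n) + (a - b) * (c * c ^ n)   ≡⟨ solve 4 (λ c i d p → c :* ((i :* d) :* p) :+ d :* (c :* p) := ((con 1ℚ :+ i) :* d) :* (c :* p))
                                                                  refl c (ι n) (a - b) (c ^ n) ⟩
      ((1ℚ + ι n) * (a - b)) * (c * c ^ n)                    ≡⟨ cong (λ i → (i * (a - b)) * (c * c ^ n)) (sym (ι-suc n)) ⟩
      (ι (suc n) * (a - b)) * (c * c ^ n)                     ∎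
      where
      0≤a = ℚₚ.≤-trans 0≤b b≤a
      0≤c = ℚₚ.≤-trans 0≤a a≤c
      cⁿ≤ : c ^ n ≤ c * c ^ n
      cⁿ≤ = ℚₚ.≤-trans (ℚₚ.≤-reflexive (sym (ℚₚ.*-identityˡ (c ^ n)))) (*-monoʳ (0≤^ n 0≤c) 1≤c)

    compound-lipschitz-≤ : ∀ {p q} n → InRange p → InRange q → C ℕ.≤ n → p ≤ q →
      compound q n - compound p n ≤ (q - p) * compoundBound C
    compound-lipschitz-≤ {p} {q} n (h , h′) (g , g′) C≤n p≤q = begin
      compound q n - compound p n    ≤⟨ pow-lipschitz {1ℚ + q * u} {1ℚ + p * u} {c} (suc n) (0≤1+step n (ℚₚ.≤-trans h′ (ι-mono (ℕ.s≤s C≤n))))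
                                          (ℚₚ.+-monoʳ-≤ 1ℚ (*-monoʳ (0≤1/suc n) p≤q)) (ℚₚ.+-monoʳ-≤ 1ℚ (*-monoʳ (0≤1/suc n) g))
                                          (ℚₚ.≤-trans (ℚₚ.≤-reflexive (sym (ℚₚ.+-identityʳ 1ℚ))) (ℚₚ.+-monoʳ-≤ 1ℚ (0≤* (0≤ι (suc C)) (0≤1/suc n)))) ⟩
      (ι (suc n) * ((1ℚ + q * u) - (1ℚ + p * u))) * compound (ι (suc C)) n   ≡⟨ cong (_* compound (ι (suc C)) n) (begin-equality
          ι (suc n) * ((1ℚ + q * u) - (1ℚ + p * u))  ≡⟨ solve 4 (λ i q p u → i :* ((con 1ℚ :+ q :* u) :- (con 1ℚ :+ p :* u)) := (i :* u) :* (q :- p)) refl (ι (suc n)) q p u ⟩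
          (ι (suc n) * u) * (q - p)                  ≡⟨ cong (_* (q - p)) (ι*1/suc n) ⟩
          1ℚ * (q - p)                               ≡⟨ ℚₚ.*-identityˡ (q - p) ⟩
          q - p                                      ∎) ⟩
      (q - p) * compound (ι (suc C)) n   ≤⟨ *-monoˡ (≤⇒0≤- p≤q) (compound-ι≤ C n) ⟩
      (q - p) * compoundBound C          ∎
      where
      u = 1/suc n
      c = 1ℚ + ι (suc C) * u

    compound-lipschitz : ∀ {p q} n → InRange p → InRange q → C ℕ.≤ n →
      ∣ compound p n - compound q n ∣ ≤ ∣ p - q ∣ * compoundBound C
    compound-lipschitz {p} {q} n hp hq C≤n = [ below , above ]′ (ℚₚ.≤-total p q)
      where
      0≤+n : ∀ {p} → InRange p → - p ≤ ι (suc n)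
      0≤+n h = ℚₚ.≤-trans (proj₂ h) (ι-mono (ℕ.s≤s C≤n))
      below : p ≤ q → ∣ compound p n - compound q n ∣ ≤ ∣ p - q ∣ * compoundBound C
      below p≤q = ℚₚ.≤-trans
        (∣-∣-sym-≤ (compound-mono n (0≤+n hp) p≤q) (compound-lipschitz-≤ n hp hq C≤n p≤q))
        (*-monoʳ (0≤compoundBound C) (ℚₚ.≤-trans (p≤∣p∣ (q - p)) (ℚₚ.≤-reflexive (∣p-q∣≡∣q-p∣ q p))))
      above : q ≤ p → ∣ compound p n - compound q n ∣ ≤ ∣ p - q ∣ * compoundBound C
      above q≤p = ℚₚ.≤-trans (ℚₚ.≤-reflexive (∣p-q∣≡∣q-p∣ (compound p n) (compound q n))) (ℚₚ.≤-trans
        (∣-∣-sym-≤ (compound-mono n (0≤+n hq) q≤p) (compound-lipschitz-≤ n hq hp C≤n q≤p))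
        (*-monoʳ (0≤compoundBound C) (p≤∣p∣ (p - q))))

  compound-neg≤ : ∀ {q} n → 0ℚ ≤ q → q ≤ ι (suc n) → compound (- q) n * (1ℚ + q) ≤ 1ℚ
  compound-neg≤ {q} n 0≤q q≤n = begin
    compound (- q) n * (1ℚ + q)                               ≡⟨ cong (λ z → z ^ suc n * (1ℚ + q)) 1-qu ⟩
    (1ℚ - q * u) ^ suc n * (1ℚ + q)                           ≤⟨ *-monoˡ (0≤^ (suc n) 0≤1-qu) (subst (_≤ (1ℚ + q * u) ^ suc n) (cong (1ℚ +_) (begin-equality
        ι (suc n) * (q * u)  ≡⟨ solve 3 (λ i q u → i :* (q :* u) := (i :* u) :* q) refl (ι (suc n)) q u ⟩
        (ι (suc n) * u) * q  ≡⟨ cong (_* q) (ι*1/suc n) ⟩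
        1ℚ * q               ≡⟨ ℚₚ.*-identityˡ q ⟩
        q                    ∎)) (bernoulli-inequality (suc n) 0≤1+qu)) ⟩
    (1ℚ - q * u) ^ suc n * (1ℚ + q * u) ^ suc n               ≡⟨ ℚₚ.*-comm ((1ℚ - q * u) ^ suc n) ((1ℚ + q * u) ^ suc n) ⟩
    (1ℚ + q * u) ^ suc n * (1ℚ - q * u) ^ suc n               ≤⟨ paired-≤1 (suc n) {q * u} 0≤1+qu 0≤1-qu ⟩
    1ℚ                                                        ∎
    where
    u = 1/suc n
    0≤1+qu = 0≤1+nonNeg n 0≤q
    0≤1-qu = 0≤1-step n q≤n
    1-qu : 1ℚ + (- q) * u ≡ 1ℚ - q * u
    1-qu = solve 2 (λ q u → con 1ℚ :+ (:- q) :* u := con 1ℚ :- q :* u) refl q u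

open RationalLemmas

Eventually : (ℕ → Set) → Set
Eventually P = Σ[ N ∈ ℕ ] (∀ n → N ℕ.≤ n → P n)

infixr 2 _and_
_and_ : ∀ {P Q} → Eventually P → Eventually Q → Eventually (λ n → P n × Q n)
(M , p) and (N , q) = M ℕ.⊔ N , λ n le →
  p n (ℕₚ.≤-trans (ℕₚ.m≤m⊔n M N) le) , q n (ℕₚ.≤-trans (ℕₚ.m≤n⊔m M N) le)

after : ∀ N → Eventually (N ℕ.≤_)
after N = N , λ _ le → le

IsCauchy : (ℕ → ℚ) → Set
IsCauchy f = ∀ ε → 0ℚ ℚ.< ε →
  Σ[ N ∈ ℕ ] (∀ m n → N ℕ.≤ m → N ℕ.≤ n → ℚ.∣ f m ℚ.- f n ∣ ℚ.≤ ε)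

-- The convergence modulus is part of the data.
record ℝ : Set where
  constructor real
  field
    seq    : ℕ → ℚ
    cauchy : IsCauchy seq

open ℝ public

module CauchyLemmas where

  open ℚ using (_+_; _*_; -_; _-_; _≤_; _<_; ∣_∣)
  open ℚₚ.≤-Reasoning
  open +-*-Solver using (solve; _:+_; _:*_; :-_; _:-_; _:=_; con)

  const-cauchy : ∀ q → IsCauchy (λ _ → q)
  const-cauchy q ε 0<ε = 0 , λ _ _ _ _ →
    ℚₚ.≤-trans (ℚₚ.≤-reflexive (cong ∣_∣ (ℚₚ.+-inverseʳ q))) (ℚₚ.<⇒≤ 0<ε)

  neg-cauchy : ∀ {f} → IsCauchy f → IsCauchy (λ n → - f n)
  neg-cauchy {f} cf ε 0<ε = proj₁ (cf ε 0<ε) , λ m n N≤m N≤n →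
    subst (_≤ ε) (trans (sym (ℚₚ.∣-p∣≡∣p∣ (f m - f n)))
      (cong ∣_∣ (solve 2 (λ a b → :- (a :- b) := (:- a) :- (:- b)) refl (f m) (f n))))
      (proj₂ (cf ε 0<ε) m n N≤m N≤n)

  +-cauchy : ∀ {f g} → IsCauchy f → IsCauchy g → IsCauchy (λ n → f n + g n)
  +-cauchy {f} {g} cf cg ε 0<ε = M ℕ.⊔ N , λ m n le₁ le₂ → begin
    ∣ (f m + g m) - (f n + g n) ∣  ≡⟨ cong ∣_∣ (solve 4 (λ a b c d → (a :+ b) :- (c :+ d) := (a :- c) :+ (b :- d)) refl (f m) (g m) (f n) (g n)) ⟩
    ∣ (f m - f n) + (g m - g n) ∣  ≤⟨ ℚₚ.∣p+q∣≤∣p∣+∣q∣ (f m - f n) (g m - g n) ⟩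
    ∣ f m - f n ∣ + ∣ g m - g n ∣  ≤⟨ ℚₚ.+-mono-≤
                                        (hf m n (ℕₚ.≤-trans (ℕₚ.m≤m⊔n M N) le₁) (ℕₚ.≤-trans (ℕₚ.m≤m⊔n M N) le₂))
                                        (hg m n (ℕₚ.≤-trans (ℕₚ.m≤n⊔m M N) le₁) (ℕₚ.≤-trans (ℕₚ.m≤n⊔m M N) le₂)) ⟩
    ε * ℚ.½ + ε * ℚ.½              ≡⟨ half-sum ε ⟩
    ε                              ∎
    where
    M = proj₁ (cf (ε * ℚ.½) (0<half 0<ε))
    hf = proj₂ (cf (ε * ℚ.½) (0<half 0<ε))
    N = proj₁ (cg (ε * ℚ.½) (0<half 0<ε))
    hg = proj₂ (cg (ε * ℚ.½) (0<half 0<ε))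

  bounded : ∀ {f} → IsCauchy f → Σ[ C ∈ ℕ ] Eventually (λ n → ∣ f n ∣ ≤ ι C)
  bounded {f} cf = C , N , λ n N≤n → begin
    ∣ f n ∣                    ≡⟨ cong ∣_∣ (solve 2 (λ a b → a := (a :- b) :+ b) refl (f n) (f N)) ⟩
    ∣ (f n - f N) + f N ∣      ≤⟨ ℚₚ.∣p+q∣≤∣p∣+∣q∣ (f n - f N) (f N) ⟩
    ∣ f n - f N ∣ + ∣ f N ∣    ≤⟨ ℚₚ.+-monoˡ-≤ ∣ f N ∣ (h n N N≤n ℕₚ.≤-refl) ⟩
    1ℚ + ∣ f N ∣               ≤⟨ proj₂ (archimedean (1ℚ + ∣ f N ∣)) ⟩
    ι C                        ∎
    where
    N = proj₁ (cf 1ℚ (0<ι 0))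
    h = proj₂ (cf 1ℚ (0<ι 0))
    C = proj₁ (archimedean (1ℚ + ∣ f N ∣))

  -- δ is such that p ≤ δ implies p * B ≤ ε
  shrink : ∀ {B ε} → 0ℚ ≤ B → 0ℚ < ε → Σ[ δ ∈ ℚ ] (0ℚ < δ × (∀ {p} → p ≤ δ → p * B ≤ ε))
  shrink {B} {ε} 0≤B 0<ε = δ , 0<δ , λ {p} p≤δ → begin
    p * B             ≤⟨ *-monoʳ 0≤B p≤δ ⟩
    δ * B             ≤⟨ *-monoˡ (ℚₚ.<⇒≤ 0<δ) (ℚₚ.≤-trans (ℚₚ.≤-reflexive (sym (ℚₚ.+-identityʳ B))) (ℚₚ.+-monoʳ-≤ B 0≤1)) ⟩
    δ * (B + 1ℚ)      ≡⟨ solve 3 (λ e r b → (e :* r) :* b := e :* (b :* r)) refl ε (recip (B + 1ℚ)) (B + 1ℚ) ⟩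
    ε * ((B + 1ℚ) * recip (B + 1ℚ))  ≡⟨ cong (ε *_) (recip-inverse 0<B+1) ⟩
    ε * 1ℚ            ≡⟨ ℚₚ.*-identityʳ ε ⟩
    ε                 ∎
    where
    0<B+1 : 0ℚ < B + 1ℚ
    0<B+1 = 0<+ 0≤B (0<ι 0)
    δ = ε * recip (B + 1ℚ)
    0<δ : 0ℚ < δ
    0<δ = 0<* 0<ε (0<recip 0<B+1)

  *-cauchy : ∀ {f g} → IsCauchy f → IsCauchy g → IsCauchy (λ n → f n * g n)
  *-cauchy {f} {g} cf cg ε 0<ε = K , λ m n le₁ le₂ → begin
    ∣ f m * g m - f n * g n ∣                          ≡⟨ cong ∣_∣ (solve 4 (λ a b c d → a :* b :- c :* d := (a :- c) :* b :+ (b :- d) :* c) refl (f m) (g m) (f n) (g n)) ⟩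
    ∣ (f m - f n) * g m + (g m - g n) * f n ∣          ≤⟨ ℚₚ.∣p+q∣≤∣p∣+∣q∣ ((f m - f n) * g m) ((g m - g n) * f n) ⟩
    ∣ (f m - f n) * g m ∣ + ∣ (g m - g n) * f n ∣      ≡⟨ cong₂ _+_ (ℚₚ.∣p*q∣≡∣p∣*∣q∣ (f m - f n) (g m)) (ℚₚ.∣p*q∣≡∣p∣*∣q∣ (g m - g n) (f n)) ⟩
    ∣ f m - f n ∣ * ∣ g m ∣ + ∣ g m - g n ∣ * ∣ f n ∣  ≤⟨ ℚₚ.+-mono-≤
        (ℚₚ.≤-trans (*-monoˡ (ℚₚ.0≤∣p∣ (f m - f n)) (proj₂ bg m (p₂ le₁))) (proj₂ (proj₂ sg) (proj₂ hf m n (p₃ le₁) (p₃ le₂))))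
        (ℚₚ.≤-trans (*-monoˡ (ℚₚ.0≤∣p∣ (g m - g n)) (proj₂ bf n (p₁ le₂))) (proj₂ (proj₂ sf) (proj₂ hg m n (p₄ le₁) (p₄ le₂)))) ⟩
    ε * ℚ.½ + ε * ℚ.½                                  ≡⟨ half-sum ε ⟩
    ε                                                  ∎
    where
    bf = proj₂ (bounded {f} cf)
    bg = proj₂ (bounded {g} cg)
    sf = shrink (0≤ι (proj₁ (bounded {f} cf))) (0<half 0<ε)
    sg = shrink (0≤ι (proj₁ (bounded {g} cg))) (0<half 0<ε)
    hf = cf (proj₁ sg) (proj₁ (proj₂ sg))
    hg = cg (proj₁ sf) (proj₁ (proj₂ sf))
    K = (proj₁ bf ℕ.⊔ proj₁ bg) ℕ.⊔ (proj₁ hf ℕ.⊔ proj₁ hg)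
    l : ∀ {n} → K ℕ.≤ n → proj₁ bf ℕ.⊔ proj₁ bg ℕ.≤ n
    l = ℕₚ.≤-trans (ℕₚ.m≤m⊔n (proj₁ bf ℕ.⊔ proj₁ bg) (proj₁ hf ℕ.⊔ proj₁ hg))
    r : ∀ {n} → K ℕ.≤ n → proj₁ hf ℕ.⊔ proj₁ hg ℕ.≤ n
    r = ℕₚ.≤-trans (ℕₚ.m≤n⊔m (proj₁ bf ℕ.⊔ proj₁ bg) (proj₁ hf ℕ.⊔ proj₁ hg))
    p₁ : ∀ {n} → K ℕ.≤ n → proj₁ bf ℕ.≤ n
    p₁ le = ℕₚ.≤-trans (ℕₚ.m≤m⊔n (proj₁ bf) (proj₁ bg)) (l le)
    p₂ : ∀ {n} → K ℕ.≤ n → proj₁ bg ℕ.≤ n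
    p₂ le = ℕₚ.≤-trans (ℕₚ.m≤n⊔m (proj₁ bf) (proj₁ bg)) (l le)
    p₃ : ∀ {n} → K ℕ.≤ n → proj₁ hf ℕ.≤ n
    p₃ le = ℕₚ.≤-trans (ℕₚ.m≤m⊔n (proj₁ hf) (proj₁ hg)) (r le)
    p₄ : ∀ {n} → K ℕ.≤ n → proj₁ hg ℕ.≤ n
    p₄ le = ℕₚ.≤-trans (ℕₚ.m≤n⊔m (proj₁ hf) (proj₁ hg)) (r le)

  compound-cauchy : ∀ {f} → IsCauchy f → IsCauchy (λ n → compound (f n) n)
  compound-cauchy {f} cf ε 0<ε = K , λ m n le₁ le₂ → begin
    ∣ compound (f m) m - compound (f n) n ∣  ≤⟨ triangle (compound (f m) m) (compound (f n) m) (compound (f n) n) ⟩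
    ∣ compound (f m) m - compound (f n) m ∣ + ∣ compound (f n) m - compound (f n) n ∣
      ≤⟨ ℚₚ.+-mono-≤
           (ℚₚ.≤-trans (B.compound-lipschitz m (inRange m (q₁ le₁)) (inRange n (q₁ le₂)) (q₂ le₁))
             (proj₂ (proj₂ sh) (proj₂ hf m n (q₃ le₁) (q₃ le₂))))
           (ℚₚ.≤-trans (B.same-point-error m n (inRange n (q₁ le₂)) (q₂ le₁) (q₂ le₂))
             (ℚₚ.+-mono-≤ (proj₂ sm m (q₄ le₁)) (proj₂ sm n (q₄ le₂)))) ⟩
    ε * ℚ.½ + (ε * ℚ.½ * ℚ.½ + ε * ℚ.½ * ℚ.½)  ≡⟨ cong (ε * ℚ.½ +_) (half-sum (ε * ℚ.½)) ⟩
    ε * ℚ.½ + ε * ℚ.½                          ≡⟨ half-sum ε ⟩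
    ε                                          ∎
    where
    C : ℕ
    C = proj₁ (bounded {f} cf)
    bf = proj₂ (bounded {f} cf)
    module B = Bounded C
    inRange : ∀ n → proj₁ bf ℕ.≤ n → B.InRange (f n)
    inRange n le = ℚₚ.≤-trans (p≤∣p∣ (f n)) small ,
                   ℚₚ.≤-trans (p≤∣p∣ (- f n)) (ℚₚ.≤-trans (ℚₚ.≤-reflexive (ℚₚ.∣-p∣≡∣p∣ (f n))) small)
      where small = ℚₚ.≤-trans (proj₂ bf n le) (ι-mono (ℕₚ.n≤1+n C))
    sh = shrink (0≤compoundBound C) (0<half 0<ε)
    hf = cf (proj₁ sh) (proj₁ (proj₂ sh))
    sm = small-1/suc B.0≤errorConstant (0<half (0<half 0<ε))
    K₁ = proj₁ bf ℕ.⊔ C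
    K₂ = proj₁ hf ℕ.⊔ proj₁ sm
    K = K₁ ℕ.⊔ K₂
    q₁ : ∀ {n} → K ℕ.≤ n → proj₁ bf ℕ.≤ n
    q₁ le = ℕₚ.≤-trans (ℕₚ.m≤m⊔n (proj₁ bf) C) (ℕₚ.≤-trans (ℕₚ.m≤m⊔n K₁ K₂) le)
    q₂ : ∀ {n} → K ℕ.≤ n → C ℕ.≤ n
    q₂ le = ℕₚ.≤-trans (ℕₚ.m≤n⊔m (proj₁ bf) C) (ℕₚ.≤-trans (ℕₚ.m≤m⊔n K₁ K₂) le)
    q₃ : ∀ {n} → K ℕ.≤ n → proj₁ hf ℕ.≤ n
    q₃ le = ℕₚ.≤-trans (ℕₚ.m≤m⊔n (proj₁ hf) (proj₁ sm)) (ℕₚ.≤-trans (ℕₚ.m≤n⊔m K₁ K₂) le)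
    q₄ : ∀ {n} → K ℕ.≤ n → proj₁ sm ℕ.≤ n
    q₄ le = ℕₚ.≤-trans (ℕₚ.m≤n⊔m (proj₁ hf) (proj₁ sm)) (ℕₚ.≤-trans (ℕₚ.m≤n⊔m K₁ K₂) le)

  recip-difference : ∀ {a b δ} → 0ℚ < δ → δ ≤ a → δ ≤ b →
    ∣ recip a - recip b ∣ ≤ ∣ a - b ∣ * (recip δ * recip δ)
  recip-difference {a} {b} {δ} 0<δ δ≤a δ≤b = begin
    ∣ recip a - recip b ∣                            ≡⟨ cong ∣_∣ e ⟩
    ∣ (b - a) * (recip a * recip b) ∣                ≡⟨ ℚₚ.∣p*q∣≡∣p∣*∣q∣ (b - a) (recip a * recip b) ⟩
    ∣ b - a ∣ * ∣ recip a * recip b ∣                ≡⟨ cong₂ _*_ (∣p-q∣≡∣q-p∣ b a) (ℚₚ.0≤p⇒∣p∣≡p (0≤* 0≤ra 0≤rb)) ⟩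
    ∣ a - b ∣ * (recip a * recip b)                  ≤⟨ *-monoˡ (ℚₚ.0≤∣p∣ (a - b)) (*-mono 0≤ra (recip-anti 0<δ δ≤a) 0≤rb (recip-anti 0<δ δ≤b)) ⟩
    ∣ a - b ∣ * (recip δ * recip δ)                  ∎
    where
    0<a = ℚₚ.<-≤-trans 0<δ δ≤a
    0<b = ℚₚ.<-≤-trans 0<δ δ≤b
    0≤ra = ℚₚ.<⇒≤ (0<recip 0<a)
    0≤rb = ℚₚ.<⇒≤ (0<recip 0<b)
    e : recip a - recip b ≡ (b - a) * (recip a * recip b)
    e = sym (begin-equality
      (b - a) * (recip a * recip b)                          ≡⟨ solve 4 (λ a b r s → (b :- a) :* (r :* s) := r :* (b :* s) :- s :* (a :* r)) refl a b (recip a) (recip b) ⟩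
      recip a * (b * recip b) - recip b * (a * recip a)      ≡⟨ cong₂ (λ x y → recip a * x - recip b * y) (recip-inverse 0<b) (recip-inverse 0<a) ⟩
      recip a * 1ℚ - recip b * 1ℚ                            ≡⟨ cong₂ _-_ (ℚₚ.*-identityʳ (recip a)) (ℚₚ.*-identityʳ (recip b)) ⟩
      recip a - recip b                                      ∎)

  recip-cauchy : ∀ {f δ} → 0ℚ < δ → Eventually (λ n → δ ≤ f n) → IsCauchy f → IsCauchy (λ n → recip (f n))
  recip-cauchy {f} {δ} 0<δ (N , δ≤f) cf ε 0<ε = N ℕ.⊔ M , λ m n le₁ le₂ →
    ℚₚ.≤-trans (recip-difference 0<δ (δ≤f m (ℕₚ.≤-trans (ℕₚ.m≤m⊔n N M) le₁)) (δ≤f n (ℕₚ.≤-trans (ℕₚ.m≤m⊔n N M) le₂)))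
      (proj₂ (proj₂ sh) (proj₂ hf m n (ℕₚ.≤-trans (ℕₚ.m≤n⊔m N M) le₁) (ℕₚ.≤-trans (ℕₚ.m≤n⊔m N M) le₂)))
    where
    0≤r = ℚₚ.<⇒≤ (0<recip 0<δ)
    sh = shrink (0≤* 0≤r 0≤r) 0<ε
    hf = cf (proj₁ sh) (proj₁ (proj₂ sh))
    M = proj₁ hf

-- Sealed, so that the moduli of convergence do not unfold during type checking.
abstract

  sealed-const-cauchy : ∀ q → IsCauchy (λ _ → q)
  sealed-const-cauchy = CauchyLemmas.const-cauchy

  sealed-neg-cauchy : ∀ f → IsCauchy f → IsCauchy (λ n → ℚ.- f n)
  sealed-neg-cauchy f = CauchyLemmas.neg-cauchy {f}

  sealed-+-cauchy : ∀ f g → IsCauchy f → IsCauchy g → IsCauchy (λ n → f n ℚ.+ g n)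
  sealed-+-cauchy f g = CauchyLemmas.+-cauchy {f} {g}

  sealed-*-cauchy : ∀ f g → IsCauchy f → IsCauchy g → IsCauchy (λ n → f n ℚ.* g n)
  sealed-*-cauchy f g = CauchyLemmas.*-cauchy {f} {g}

  sealed-compound-cauchy : ∀ f → IsCauchy f → IsCauchy (λ n → compound (f n) n)
  sealed-compound-cauchy f = CauchyLemmas.compound-cauchy {f}

  sealed-recip-cauchy : ∀ f {δ} → 0ℚ ℚ.< δ → Eventually (λ n → δ ℚ.≤ f n) → IsCauchy f → IsCauchy (λ n → recip (f n))
  sealed-recip-cauchy f = CauchyLemmas.recip-cauchy {f}

open CauchyLemmas using (bounded)

infix  4 _≈_ _≤_ _<_
infixl 6 _+_ _-_
infixl 7 _*_ _/_[_]
infix  8 -_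

record _≈_ (x y : ℝ) : Set where
  constructor *≈*
  field close : ∀ ε → 0ℚ ℚ.< ε → Eventually (λ n → ℚ.∣ seq x n ℚ.- seq y n ∣ ℚ.≤ ε)

record _≤_ (x y : ℝ) : Set where
  constructor *≤*
  field below : ∀ ε → 0ℚ ℚ.< ε → Eventually (λ n → seq x n ℚ.≤ seq y n ℚ.+ ε)

record _<_ (x y : ℝ) : Set where
  constructor *<*
  field
    gap     : ℚ
    0<gap   : 0ℚ ℚ.< gap
    apart   : Eventually (λ n → seq x n ℚ.+ gap ℚ.≤ seq y n)

fromℚ : ℚ → ℝ
fromℚ q = real (λ _ → q) (sealed-const-cauchy q)

fromℕ : ℕ → ℝ
fromℕ n = fromℚ (ι n)

0ℝ 1ℝ : ℝ
0ℝ = fromℕ 0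
1ℝ = fromℕ 1

_+_ : ℝ → ℝ → ℝ
x + y = real (λ n → seq x n ℚ.+ seq y n) (sealed-+-cauchy (seq x) (seq y) (cauchy x) (cauchy y))

_*_ : ℝ → ℝ → ℝ
x * y = real (λ n → seq x n ℚ.* seq y n) (sealed-*-cauchy (seq x) (seq y) (cauchy x) (cauchy y))

-_ : ℝ → ℝ
- x = real (λ n → ℚ.- seq x n) (sealed-neg-cauchy (seq x) (cauchy x))

_-_ : ℝ → ℝ → ℝ
x - y = x + - y

eventually-gap : ∀ {x} (0<x : 0ℝ < x) → Eventually (λ n → _<_.gap 0<x ℚ.≤ seq x n)
eventually-gap {x} (*<* δ _ (N , h)) = N , λ n le → subst (ℚ._≤ seq x n) (ℚₚ.+-identityˡ δ) (h n le)

inverse : (y : ℝ) → 0ℝ < y → ℝ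
inverse y 0<y = real (λ n → recip (seq y n))
  (sealed-recip-cauchy (seq y) (_<_.0<gap 0<y) (eventually-gap 0<y) (cauchy y))

_/_[_] : (x y : ℝ) → 0ℝ < y → ℝ
x / y [ 0<y ] = x * inverse y 0<y

-- eˣ = lim (1 + xₙ/(n+1))ⁿ⁺¹, where xₙ is the rational sequence converging to x
exp : ℝ → ℝ
exp x = real (λ n → compound (seq x n) n) (sealed-compound-cauchy (seq x) (cauchy x))

0<fromℕ : ∀ {n} → 1 ℕ.≤ n → 0ℝ < fromℕ n
0<fromℕ {suc n} _ = *<* (ι (suc n)) (0<ι n) (0 , λ _ _ → ℚₚ.≤-reflexive (ℚₚ.+-identityˡ (ι (suc n))))

x<y⇒0<y-x : ∀ {x y} → x < y → 0ℝ < y - x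
x<y⇒0<y-x {x} {y} (*<* δ 0<δ (N , h)) = *<* δ 0<δ (N , λ n le → ℚₚ.≤-trans
  (ℚₚ.≤-reflexive (solve 2 (λ d a → con 0ℚ :+ d := (a :+ d) :- a) refl δ (seq x n)))
  (ℚₚ.+-monoˡ-≤ (ℚ.- seq x n) (h n le)))
  where open +-*-Solver using (solve; _:+_; _:-_; _:=_; con)

0<x*y : ∀ {x y} → 0ℝ < x → 0ℝ < y → 0ℝ < x * y
0<x*y {x} {y} 0<x@(*<* δ 0<δ _) 0<y@(*<* η 0<η _) = *<* (δ ℚ.* η) (0<* 0<δ 0<η)
  (proj₁ both , λ n le → ℚₚ.≤-trans (ℚₚ.≤-reflexive (ℚₚ.+-identityˡ (δ ℚ.* η)))
    (*-mono (ℚₚ.<⇒≤ 0<δ) (proj₁ (proj₂ both n le)) (ℚₚ.<⇒≤ 0<η) (proj₂ (proj₂ both n le))))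
  where both = eventually-gap 0<x and eventually-gap 0<y

0<1-exp[-_] : ∀ {θ} → 0ℝ < θ → 0ℝ < 1ℝ - exp (- θ)
0<1-exp[-_] {θ} 0<θ@(*<* δ 0<δ _) = *<* (δ ℚ.* r) (0<* 0<δ (0<recip 0<1+δ))
    (proj₁ all , λ n le → step n (proj₂ all n le))
  where
  open ℚₚ.≤-Reasoning
  open +-*-Solver using (solve; _:+_; _:*_; :-_; _:-_; _:=_; con)
  0<1+δ : 0ℚ ℚ.< 1ℚ ℚ.+ δ
  0<1+δ = 0<+ 0≤1 0<δ
  r = recip (1ℚ ℚ.+ δ)
  C = proj₁ (bounded {seq θ} (cauchy θ))
  all = eventually-gap 0<θ and proj₂ (bounded {seq θ} (cauchy θ)) and after C
  step : ∀ n → (δ ℚ.≤ seq θ n) × (ℚ.∣ seq θ n ∣ ℚ.≤ ι C) × C ℕ.≤ n →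
         0ℚ ℚ.+ δ ℚ.* r ℚ.≤ 1ℚ ℚ.- compound (ℚ.- seq θ n) n
  step n (δ≤q , h₂ , C≤n) = begin
      0ℚ ℚ.+ δ ℚ.* r                           ≡⟨ solve 2 (λ d r → con 0ℚ :+ d :* r := (con 1ℚ :+ d) :* r :- r) refl δ r ⟩
      (1ℚ ℚ.+ δ) ℚ.* r ℚ.- r                   ≡⟨ cong (λ z → z ℚ.- r) (recip-inverse 0<1+δ) ⟩
      1ℚ ℚ.- r                                 ≤⟨ ℚₚ.+-monoʳ-≤ 1ℚ (ℚₚ.neg-antimono-≤ E≤r) ⟩
      1ℚ ℚ.- compound (ℚ.- q) n                ∎
    where
    q = seq θ n
    q≤n : q ℚ.≤ ι (suc n)
    q≤n = ℚₚ.≤-trans (p≤∣p∣ q) (ℚₚ.≤-trans h₂ (ι-mono (ℕₚ.≤-trans C≤n (ℕₚ.n≤1+n n))))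
    0≤E : 0ℚ ℚ.≤ compound (ℚ.- q) n
    0≤E = 0≤^ (suc n) (0≤1+step n (subst (ℚ._≤ ι (suc n)) (solve 1 (λ q → q := :- (:- q)) refl q) q≤n))
    E≤r : compound (ℚ.- q) n ℚ.≤ r
    E≤r = *-cancel-≤ 0<1+δ (begin
      (1ℚ ℚ.+ δ) ℚ.* compound (ℚ.- q) n        ≡⟨ ℚₚ.*-comm (1ℚ ℚ.+ δ) (compound (ℚ.- q) n) ⟩
      compound (ℚ.- q) n ℚ.* (1ℚ ℚ.+ δ)        ≤⟨ *-monoˡ 0≤E (ℚₚ.+-monoʳ-≤ 1ℚ δ≤q) ⟩
      compound (ℚ.- q) n ℚ.* (1ℚ ℚ.+ q)        ≤⟨ compound-neg≤ n (ℚₚ.≤-trans (ℚₚ.<⇒≤ 0<δ) δ≤q) q≤n ⟩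
      1ℚ                                       ≡⟨ recip-inverse 0<1+δ ⟨
      (1ℚ ℚ.+ δ) ℚ.* r                         ∎)

sumℝ : List ℝ → ℝ
sumℝ = List.foldr _+_ 0ℝ

partialSum : (ℕ → ℝ) → ℕ → ℝ
partialSum f zero    = 0ℝ
partialSum f (suc n) = partialSum f n + f n

infix 4 _sumsTo_
_sumsTo_ : (ℕ → ℝ) → ℝ → Set
f sumsTo s = ∀ ε → 0ℝ < ε →
  Σ[ N ∈ ℕ ] (∀ n → N ℕ.≤ n → s - ε < partialSum f n × partialSum f n < s + ε)

-- Weighted outcomes; the same value may occur several times.
Dist : Set → Set
Dist A = List (ℝ × A)

module _ {A : Set} where

  IsDistribution : Dist A → Set
  IsDistribution d = All (λ (w , _) → 0ℝ ≤ w) d × sumℝ (List.map proj₁ d) ≈ 1ℝ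

  Pr : Dist A → (A → Bool) → ℝ
  Pr d event = sumℝ (List.map (λ (w , a) → if event a then w else 0ℝ) d)

  return : A → Dist A
  return a = (1ℝ , a) ∷ []

  infixl 1 _>>=_
  _>>=_ : ∀ {B : Set} → Dist A → (A → Dist B) → Dist B
  d >>= f = concatMap (λ (w , a) → List.map (λ (v , b) → w * v , b) (f a)) d

  uniform : A → List A → Dist A
  uniform a as = List.map (fromℚ (1/suc (List.length as)) ,_) (a ∷ as)

bernoulli : ℝ → Dist Bool
bernoulli p = (p , true) ∷ (1ℝ - p , false) ∷ []

-- Pr[k = j] = Pr[k ≥ j] - Pr[k ≥ j + 1] for k ~ Geo(e^{-θ})
geometric : ℝ → ℕ → ℝ
geometric θ j = exp (- (θ * fromℕ j)) - exp (- (θ * fromℕ (suc j)))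

record Mechanism (Dataset : Set) : Set where
  field
    run            : Dataset → Dist Sign
    isDistribution : ∀ X → IsDistribution (run X)

  probability : Dataset → Sign → ℝ
  probability X v = Pr (run X) (λ o → does (o Signₚ.≟ v))

  IsDP : (Dataset → Dataset → Set) → ℝ → Set
  IsDP _~_ ε = ∀ {X X′} → X ~ X′ → ∀ v → probability X v ≤ exp ε * probability X′ v

  success : Dataset → ℝ
  success X = probability X Sign.+

-- nothing is ⊥
Output : ℕ → Set
Output T = Maybe (Sign × Fin T)

isPositive : ∀ {T} → Output T → Bool
isPositive (just (Sign.+ , _)) = true
isPositive _                   = false

-- The rule is uniform over the elements (+1 , t) of S when there are any;
-- fallback is its otherwise arbitrary choice from an S without such elements.
record SelectionRule (T : ℕ) : Set where
  field
    fallback                : List (Output T) → Dist (Output T)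
    fallback-isDistribution : ∀ S → nothing ∈ S → IsDistribution (fallback S)
    fallback-∈              : ∀ S → nothing ∈ S → All (λ (_ , o) → o ∈ S) (fallback S)

  select : List (Output T) → Dist (Output T)
  select S = choose (filterᵇ isPositive S)
    where
    choose : List (Output T) → Dist (Output T)
    choose []       = fallback S
    choose (o ∷ os) = uniform o os

module Algorithm {T : ℕ} {Dataset : Set} (rule : SelectionRule T) (ε₁ θ : ℝ)
                 (M : Fin T → Mechanism Dataset) (X : Dataset) where

  open SelectionRule rule

  process : ℕ → List (Fin T) → List (Output T) → Dist (List (Output T))
  process k []       S = return S
  process k (t ∷ ts) S = bernoulli (exp (- (ε₁ * fromℕ k))) >>= λ where
    false → process k ts S
    true  → Mechanism.run (M t) X >>= λ o → process k ts (just (o , t) ∷ S)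

  runWith : ℕ → Dist (Output T)
  runWith k = process k (allFin T) (nothing ∷ []) >>= select

  -- Pr[event] = Σ_k Pr[k] · Pr[event | k]
  HasProbability : (Output T → Bool) → ℝ → Set
  HasProbability event P = (λ k → geometric θ k * Pr (runWith k) event) sumsTo P

θ_G : ℝ → ℝ → ℝ
θ_G ε₁ ε = ε - fromℕ 2 * ε₁

-- p̄ is a threshold for success probabilities, hence in [0,1]; good is the set of
-- the G indices with p_t ≥ p*.
record Setting (ε₁ ε : ℝ) : Set₁ where
  field
    β p* p̄  : ℝ
    T G     : ℕ
    0<β     : 0ℝ < β
    β<½     : β < fromℚ ℚ.½
    β≤      : β ≤ (1ℝ - exp (- θ_G ε₁ ε)) * fromℚ ℚ.½
    2≤T     : 2 ℕ.≤ T
    1≤G     : 1 ℕ.≤ G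
    G+2≤T   : G ℕ.+ 2 ℕ.≤ T
    0<p*    : 0ℝ < p*
    p*<1    : p* < 1ℝ
    0≤p̄     : 0ℝ ≤ p̄
    p̄≤1     : p̄ ≤ 1ℝ
    Dataset : Set
    _~_     : Dataset → Dataset → Set
    X       : Dataset
    rule    : SelectionRule T
    good    : Subset T
    ∣good∣≡G : Subset.∣ good ∣ ≡ G

  1≤T∸G : 1 ℕ.≤ T ℕ.∸ G
  1≤T∸G = ℕₚ.m<n⇒0<n∸m (ℕₚ.≤-trans (ℕₚ.≤-trans (ℕₚ.≤-reflexive (ℕₚ.+-comm 1 G)) (ℕₚ.+-monoʳ-≤ G (ℕ.s≤s ℕ.z≤n))) G+2≤T)

  0<T-G : 0ℝ < fromℕ (T ℕ.∸ G)
  0<T-G = 0<fromℕ 1≤T∸G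

  record Admissible (M : Fin T → Mechanism Dataset) : Set where
    field
      isDP      : ∀ t → Mechanism.IsDP (M t) _~_ ε₁
      good-≥    : ∀ t → t Subset.∈ good → p* ≤ Mechanism.success (M t) X
      bad-≤     : ∀ t → t Subset.∉ good → Mechanism.success (M t) X ≤ p̄

  -- The output is (+1 , t) with p_t ≤ p̄.  The order on ℝ is not decidable, so
  -- membership in the event is relative to a choice of decisions.
  isLow : (M : Fin T → Mechanism Dataset) →
          (∀ t → Dec (Mechanism.success (M t) X ≤ p̄)) → Output T → Bool
  isLow M low? (just (Sign.+ , t)) = does (low? t)
  isLow M low? _                   = false

  -- The bound β on the probability is a guarantee over all admissible mechanisms:
  -- for one fixed family (say p_t = 0 for every bad t) it would not constrain p̄.
  LowOutputRare : Set
  LowOutputRare = ∀ M → Admissible M → (low? : ∀ t → Dec (Mechanism.success (M t) X ≤ p̄)) →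
    ∃ λ P → Algorithm.HasProbability rule ε₁ (θ_G ε₁ ε) M X (isLow M low?) P × P ≤ β

-- The bound on the output probability is applied to independent coins: rate p* at
-- the good indices and p̄ at the others.  All terms of the sum over k are
-- nonnegative and k = 0 keeps every mechanism, so with D = 1 - e^{-θ_G} the
-- undropped run returns a bad +1 with probability at most β/D.  Let μ = (T - G)p̄,
-- ν = Gp* and a = 1 + μ + ν.  If N_B bad and N_G good coins show +1, that probability
-- is at least E[N_B/(N_B + N_G)], and the tangent 1/m ≥ 2/a - m/a² of 1/m at a bounds
-- it below by a quadratic form in N_B and N_G, whose expectation is at least μ/a.
-- Hence Dμ ≤ βa = β(1 + ν) + βμ, and βμ ≤ Dμ/2 by the hypothesis on β.

module Submission where

open import Defs
open import Data.Nat.Base using (_∸_)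
open import Data.Product.Base using (∃; _×_)

open import Data.Bool.Base using (Bool; true; false; not; if_then_else_)
open import Data.Empty using (⊥-elim)
open import Data.Fin.Base using (Fin; zero; suc)
open import Data.Fin.Subset using (Subset; ∣_∣; ∁)
import Data.Fin.Subset as Subset
import Data.Fin.Subset.Properties as Subsetₚ
open import Data.List.Base using (List; []; _∷_; _++_; map; filterᵇ; length; tabulate; allFin)
open import Data.List.Membership.Propositional using (_∈_)
open import Data.List.Relation.Unary.All using (All; []; _∷_)
open import Data.List.Relation.Unary.Any using (here; there)
open import Data.Maybe.Base using (just; nothing)
open import Data.Nat.Base as ℕ using (ℕ; suc)
import Data.Nat.Properties as ℕₚ
open import Data.Product.Base using (∃₂; _,_; proj₁; proj₂)
open import Data.Rational.Base as ℚ using (ℚ; 0ℚ; 1ℚ)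
import Data.Rational.Properties as ℚₚ
open import Data.Rational.Solver using (module +-*-Solver)
open import Data.Sign.Base as Sign using (Sign)
import Data.Sign.Properties as Signₚ
open import Data.Sum.Base using (_⊎_; inj₁; inj₂; [_,_]′)
open import Data.Vec.Base using ([]; _∷_; lookup)
import Data.Vec.Properties as Vecₚ
open import Relation.Binary.Bundles using (Preorder)
open import Relation.Binary.PropositionalEquality
  using (_≡_; refl; sym; trans; cong; cong₂; subst; subst₂)
open import Relation.Nullary using (¬_; Dec; yes; does)
open import Relation.Nullary.Decidable using (map′; ¬¬-excluded-middle; decidable-stable)

open RationalLemmas
open +-*-Solver using (solve; _:+_; _:*_; :-_; _:-_; _:=_; con)

-- Order on the reals

-- Pointwise equality of the representing sequences: ring identities over ℚ transfer
-- to it index by index.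
infix 4 _≐_
_≐_ : ℝ → ℝ → Set
x ≐ y = ∀ n → seq x n ≡ seq y n

eventually-≤ : ∀ {x y} → Eventually (λ n → seq x n ℚ.≤ seq y n) → x ≤ y
eventually-≤ {x} {y} (N , h) = *≤* λ ε 0<ε → N , λ n N≤n → ℚₚ.≤-trans (h n N≤n)
  (ℚₚ.≤-trans (ℚₚ.≤-reflexive (sym (ℚₚ.+-identityʳ (seq y n)))) (ℚₚ.+-monoʳ-≤ (seq y n) (ℚₚ.<⇒≤ 0<ε)))

pointwise-≤ : ∀ {x y} → (∀ n → seq x n ℚ.≤ seq y n) → x ≤ y
pointwise-≤ h = eventually-≤ (0 , λ n _ → h n)

≐⇒≤ : ∀ {x y} → x ≐ y → x ≤ y
≐⇒≤ {x} {y} h = pointwise-≤ {x} {y} (λ n → ℚₚ.≤-reflexive (h n))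

≤-refl : ∀ {x} → x ≤ x
≤-refl {x} = ≐⇒≤ {x} {x} (λ _ → refl)

≤-trans : ∀ {x y z} → x ≤ y → y ≤ z → x ≤ z
≤-trans {x} {y} {z} (*≤* f) (*≤* g) = *≤* λ ε 0<ε →
  let N , h = f (ε ℚ.* ℚ.½) (0<half 0<ε) and g (ε ℚ.* ℚ.½) (0<half 0<ε)
  in N , λ n N≤n → begin
    seq x n                                   ≤⟨ proj₁ (h n N≤n) ⟩
    seq y n ℚ.+ ε ℚ.* ℚ.½                     ≤⟨ ℚₚ.+-monoˡ-≤ (ε ℚ.* ℚ.½) (proj₂ (h n N≤n)) ⟩
    (seq z n ℚ.+ ε ℚ.* ℚ.½) ℚ.+ ε ℚ.* ℚ.½     ≡⟨ solve 2 (λ z e →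
      (z :+ e :* con ℚ.½) :+ e :* con ℚ.½ := z :+ e) refl (seq z n) ε ⟩
    seq z n ℚ.+ ε                             ∎
  where open ℚₚ.≤-Reasoning

≤-preorder : Preorder _ _ _
≤-preorder = record
  { Carrier = ℝ
  ; _≈_ = _≐_
  ; _≲_ = _≤_
  ; isPreorder = record
    { isEquivalence = record
      { refl = λ _ → refl ; sym = λ h n → sym (h n) ; trans = λ h g n → trans (h n) (g n) }
    ; reflexive = ≐⇒≤
    ; trans = ≤-trans
    }
  }

module ≤-Reasoning where
  open import Relation.Binary.Reasoning.Preorder ≤-preorder public

+-mono-≤ : ∀ {x y z w} → x ≤ y → z ≤ w → x + z ≤ y + w
+-mono-≤ {x} {y} {z} {w} (*≤* f) (*≤* g) = *≤* λ ε 0<ε →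
  let N , h = f (ε ℚ.* ℚ.½) (0<half 0<ε) and g (ε ℚ.* ℚ.½) (0<half 0<ε)
  in N , λ n N≤n → ℚₚ.≤-trans (ℚₚ.+-mono-≤ (proj₁ (h n N≤n)) (proj₂ (h n N≤n)))
    (ℚₚ.≤-reflexive (solve 3 (λ y w e → (y :+ e :* con ℚ.½) :+ (w :+ e :* con ℚ.½) := (y :+ w) :+ e)
      refl (seq y n) (seq w n) ε))

x≤y⇒0≤y-x : ∀ {x y} → x ≤ y → 0ℝ ≤ y - x
x≤y⇒0≤y-x {x} {y} h = begin
  0ℝ      ≈⟨ (λ n → sym (ℚₚ.+-inverseʳ (seq x n))) ⟩
  x - x   ≲⟨ +-mono-≤ h ≤-refl ⟩
  y - x   ∎
  where open ≤-Reasoning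

0≤y-x⇒x≤y : ∀ {x y} → 0ℝ ≤ y - x → x ≤ y
0≤y-x⇒x≤y {x} {y} h = begin
  x            ≈⟨ (λ n → sym (ℚₚ.+-identityˡ (seq x n))) ⟩
  0ℝ + x       ≲⟨ +-mono-≤ h ≤-refl ⟩
  (y - x) + x  ≈⟨ (λ n → solve 2 (λ x y → (y :- x) :+ x := y) refl (seq x n) (seq y n)) ⟩
  y            ∎
  where open ≤-Reasoning

0≤x+y : ∀ {x y} → 0ℝ ≤ x → 0ℝ ≤ y → 0ℝ ≤ x + y
0≤x+y {x} {y} h g = ≤-trans (pointwise-≤ (λ _ → ℚₚ.≤-refl)) (+-mono-≤ h g)

-- `0ℝ ≤ x` only gives `seq x n ≥ -e` eventually, so the shifted product (x + e)(y + e) is what is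
-- nonnegative. Its excess over xy is e(x + y + e), which the bounds `C` and `D` and the cap e ≤ 1
-- make at most e(C + D + 1), hence at most ε.
0≤x*y : ∀ {x y} → 0ℝ ≤ x → 0ℝ ≤ y → 0ℝ ≤ x * y
0≤x*y {x} {y} (*≤* f) (*≤* g) = *≤* λ ε 0<ε →
  let C , bx = CauchyLemmas.bounded (cauchy x)
      D , by = CauchyLemmas.bounded (cauchy y)
      δ , 0<δ , δ*B≤ε = CauchyLemmas.shrink {ι C ℚ.+ ι D ℚ.+ 1ℚ}
        (0≤+ (0≤+ (0≤ι C) (0≤ι D)) 0≤1) 0<ε
      e = δ ℚ.⊓ 1ℚ
      0<e = 0<⊓ 0<δ (0<ι 0)
      0≤e = ℚₚ.<⇒≤ 0<e
      N , h = f e 0<e and g e 0<e and bx and by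
  in N , λ n N≤n →
    let 0≤x+e , 0≤y+e , ∣x∣≤C , ∣y∣≤D = h n N≤n in begin
    0ℚ                                                         ≤⟨ 0≤* 0≤x+e 0≤y+e ⟩
    (seq x n ℚ.+ e) ℚ.* (seq y n ℚ.+ e)                        ≡⟨ solve 3 (λ x y e →
      (x :+ e) :* (y :+ e) := x :* y :+ e :* (x :+ y :+ e)) refl (seq x n) (seq y n) e ⟩
    seq x n ℚ.* seq y n ℚ.+ e ℚ.* (seq x n ℚ.+ seq y n ℚ.+ e)  ≤⟨ ℚₚ.+-monoʳ-≤ (seq x n ℚ.* seq y n)
      (*-monoˡ 0≤e (ℚₚ.+-mono-≤ (ℚₚ.+-mono-≤
        (ℚₚ.≤-trans (p≤∣p∣ (seq x n)) ∣x∣≤C) (ℚₚ.≤-trans (p≤∣p∣ (seq y n)) ∣y∣≤D)) (ℚₚ.p⊓q≤q δ 1ℚ))) ⟩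
    seq x n ℚ.* seq y n ℚ.+ e ℚ.* (ι C ℚ.+ ι D ℚ.+ 1ℚ)         ≤⟨ ℚₚ.+-monoʳ-≤ (seq x n ℚ.* seq y n)
      (δ*B≤ε (ℚₚ.p⊓q≤p δ 1ℚ)) ⟩
    seq x n ℚ.* seq y n ℚ.+ ε                                  ∎
  where
  open ℚₚ.≤-Reasoning
  0<⊓ : ∀ {p q} → 0ℚ ℚ.< p → 0ℚ ℚ.< q → 0ℚ ℚ.< p ℚ.⊓ q
  0<⊓ {p} {q} 0<p 0<q with ℚₚ.⊓-sel p q
  ... | inj₁ e = subst (0ℚ ℚ.<_) (sym e) 0<p
  ... | inj₂ e = subst (0ℚ ℚ.<_) (sym e) 0<q

*-monoʳ-≤ : ∀ {x y z} → 0ℝ ≤ z → x ≤ y → z * x ≤ z * y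
*-monoʳ-≤ {x} {y} {z} 0≤z x≤y = 0≤y-x⇒x≤y (≤-trans (0≤x*y 0≤z (x≤y⇒0≤y-x x≤y))
  (≐⇒≤ λ n → solve 3 (λ x y z → z :* (y :- x) := z :* y :- z :* x) refl (seq x n) (seq y n) (seq z n)))

<⇒≤ : ∀ {x y} → x < y → x ≤ y
<⇒≤ {x} {y} (*<* δ 0<δ (N , h)) = eventually-≤ (N , λ n N≤n → ℚₚ.≤-trans
  (ℚₚ.≤-trans (ℚₚ.≤-reflexive (sym (ℚₚ.+-identityʳ (seq x n)))) (ℚₚ.+-monoʳ-≤ (seq x n) (ℚₚ.<⇒≤ 0<δ)))
  (h n N≤n))

≐⇒≈ : ∀ {x y} → x ≐ y → x ≈ y
≐⇒≈ {x} {y} h = *≈* λ ε 0<ε → 0 , λ n _ → ℚₚ.≤-trans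
  (ℚₚ.≤-reflexive (cong ℚ.∣_∣ (trans (cong (ℚ._- seq y n) (h n)) (ℚₚ.+-inverseʳ (seq y n))))) (ℚₚ.<⇒≤ 0<ε)

-- A comparison of x and y at an index past both Cauchy moduli is a comparison of
-- rationals, which is decidable.
≤-stable : ∀ {x y} → ¬ ¬ (x ≤ y) → x ≤ y
≤-stable {x} {y} ¬¬x≤y = *≤* below
  where
  open ℚₚ.≤-Reasoning
  close : ∀ {p q r} → ℚ.∣ p ℚ.- q ∣ ℚ.≤ r → p ℚ.≤ q ℚ.+ r
  close {p} {q} {r} h = begin
    p                ≡⟨ solve 2 (λ p q → p := q :+ (p :- q)) refl p q ⟩
    q ℚ.+ (p ℚ.- q)  ≤⟨ ℚₚ.+-monoʳ-≤ q (ℚₚ.≤-trans (p≤∣p∣ (p ℚ.- q)) h) ⟩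
    q ℚ.+ r          ∎
  transport : ∀ {p p′ s s′ q r} → p ℚ.≤ p′ ℚ.+ q → p′ ℚ.≤ s′ ℚ.+ r → s′ ℚ.≤ s ℚ.+ q →
    p ℚ.≤ s ℚ.+ (q ℚ.+ q ℚ.+ r)
  transport {p} {p′} {s} {s′} {q} {r} h₁ h₂ h₃ = begin
    p                            ≤⟨ h₁ ⟩
    p′ ℚ.+ q                     ≤⟨ ℚₚ.+-monoˡ-≤ q h₂ ⟩
    (s′ ℚ.+ r) ℚ.+ q             ≤⟨ ℚₚ.+-monoˡ-≤ q (ℚₚ.+-monoˡ-≤ r h₃) ⟩
    ((s ℚ.+ q) ℚ.+ r) ℚ.+ q      ≡⟨ solve 3 (λ s q r → ((s :+ q) :+ r) :+ q := s :+ (q :+ q :+ r)) refl s q r ⟩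
    s ℚ.+ (q ℚ.+ q ℚ.+ r)        ∎
  below : ∀ ε → 0ℚ ℚ.< ε → Eventually (λ n → seq x n ℚ.≤ seq y n ℚ.+ ε)
  below ε 0<ε = N , λ n N≤n → subst (λ z → seq x n ℚ.≤ seq y n ℚ.+ z) parts
      (transport {s = seq y n} {seq y N} {q} {q ℚ.+ q ℚ.+ ε ℚ.* ℚ.½} (close (cauchyˣ n N N≤n ℕₚ.≤-refl)) below-at-N (close (cauchyʸ N n ℕₚ.≤-refl N≤n)))
    where
    -- The Cauchy error ε/8 is spent four times: twice between `n` and `N`, twice between `N` and
    -- the index `K` of `from`. The other ε/2 is the tolerance granted by `x ≤ y`.
    q = ε ℚ.* ℚ.½ ℚ.* ℚ.½ ℚ.* ℚ.½
    0<q = 0<half (0<half (0<half 0<ε))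
    parts : q ℚ.+ q ℚ.+ (q ℚ.+ q ℚ.+ ε ℚ.* ℚ.½) ≡ ε
    parts = solve 1 (λ e → let q = e :* con ℚ.½ :* con ℚ.½ :* con ℚ.½ in
      q :+ q :+ (q :+ q :+ e :* con ℚ.½) := e) refl ε
    N = proj₁ (cauchy x q 0<q) ℕ.⊔ proj₁ (cauchy y q 0<q)
    cauchyˣ : ∀ m n → N ℕ.≤ m → N ℕ.≤ n → ℚ.∣ seq x m ℚ.- seq x n ∣ ℚ.≤ q
    cauchyˣ m n N≤m N≤n = proj₂ (cauchy x q 0<q) m n
      (ℕₚ.≤-trans (ℕₚ.m≤m⊔n _ _) N≤m) (ℕₚ.≤-trans (ℕₚ.m≤m⊔n _ _) N≤n)
    cauchyʸ : ∀ m n → N ℕ.≤ m → N ℕ.≤ n → ℚ.∣ seq y m ℚ.- seq y n ∣ ℚ.≤ q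
    cauchyʸ m n N≤m N≤n = proj₂ (cauchy y q 0<q) m n
      (ℕₚ.≤-trans (ℕₚ.m≤n⊔m _ _) N≤m) (ℕₚ.≤-trans (ℕₚ.m≤n⊔m _ _) N≤n)
    from : x ≤ y → seq x N ℚ.≤ seq y N ℚ.+ (q ℚ.+ q ℚ.+ ε ℚ.* ℚ.½)
    from (*≤* h) =
      let M , x≤y = h (ε ℚ.* ℚ.½) (0<half 0<ε)
          K = M ℕ.⊔ N
          N≤K = ℕₚ.m≤n⊔m M N
      in transport {s = seq y N} {seq y K} {q} {ε ℚ.* ℚ.½} (close (cauchyˣ N K ℕₚ.≤-refl N≤K))
        (x≤y K (ℕₚ.m≤m⊔n M N)) (close (cauchyʸ K N N≤K ℕₚ.≤-refl))
    below-at-N : seq x N ℚ.≤ seq y N ℚ.+ (q ℚ.+ q ℚ.+ ε ℚ.* ℚ.½)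
    below-at-N = decidable-stable (_ ℚₚ.≤? _) (λ ¬h → ¬¬x≤y (λ x≤y → ¬h (from x≤y)))

0<1+x : ∀ {x} → 0ℝ ≤ x → 0ℝ < 1ℝ + x
0<1+x {x} (*≤* f) = let N , h = f ℚ.½ 0<½ in *<* ℚ.½ 0<½ (N , λ n N≤n → begin
    0ℚ ℚ.+ ℚ.½               ≡⟨⟩
    ℚ.½ ℚ.+ 0ℚ               ≤⟨ ℚₚ.+-monoʳ-≤ ℚ.½ (h n N≤n) ⟩
    ℚ.½ ℚ.+ (seq x n ℚ.+ ℚ.½)  ≡⟨ solve 1 (λ x → con ℚ.½ :+ (x :+ con ℚ.½) := con 1ℚ :+ x) refl (seq x n) ⟩
    1ℚ ℚ.+ seq x n           ∎)
  where open ℚₚ.≤-Reasoning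

-- Reciprocals and division

-- Early terms of `seq y` may vanish, where `recip` takes the default value 0, so the identity is
-- claimed only from the index at which the gap takes effect.
inverse-inverts : ∀ {y} (0<y : 0ℝ < y) → Eventually (λ n → seq y n ℚ.* seq (inverse y 0<y) n ≡ 1ℚ)
inverse-inverts 0<y = let N , h = eventually-gap 0<y in
  N , λ n N≤n → recip-inverse (ℚₚ.<-≤-trans (_<_.0<gap 0<y) (h n N≤n))

0≤inverse : ∀ {y} (0<y : 0ℝ < y) → 0ℝ ≤ inverse y 0<y
0≤inverse 0<y = let N , h = eventually-gap 0<y in
  eventually-≤ (N , λ n N≤n → ℚₚ.<⇒≤ (0<recip (ℚₚ.<-≤-trans (_<_.0<gap 0<y) (h n N≤n))))

cancel-inverse : ∀ {y} x (0<y : 0ℝ < y) → x ≤ y * (x * inverse y 0<y)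
cancel-inverse {y} x 0<y = let N , h = inverse-inverts 0<y in
  eventually-≤ (N , λ n N≤n → ℚₚ.≤-reflexive (trans (sym (ℚₚ.*-identityʳ (seq x n)))
    (trans (cong (seq x n ℚ.*_) (sym (h n N≤n)))
      (solve 3 (λ x y i → x :* (y :* i) := y :* (x :* i)) refl (seq x n) (seq y n) (seq (inverse y 0<y) n)))))

x*y≤z⇒x≤z/y : ∀ {x y z} (0<y : 0ℝ < y) → x * y ≤ z → x ≤ z / y [ 0<y ]
x*y≤z⇒x≤z/y {x} {y} {z} 0<y h = begin
  x                          ≲⟨ cancel-inverse x 0<y ⟩
  y * (x * inverse y 0<y)    ≈⟨ (λ n → solve 3 (λ x y i →
    y :* (x :* i) := i :* (x :* y)) refl (seq x n) (seq y n) (seq (inverse y 0<y) n)) ⟩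
  inverse y 0<y * (x * y)    ≲⟨ *-monoʳ-≤ (0≤inverse 0<y) h ⟩
  inverse y 0<y * z          ≈⟨ (λ n → ℚₚ.*-comm (seq (inverse y 0<y) n) (seq z n)) ⟩
  z * inverse y 0<y          ∎
  where open ≤-Reasoning

-- Exponentials and geometric weights

-- A Cauchy sequence is bounded while n + 1 grows. This makes the base 1 + x_n/(n + 1) of `compound`
-- nonnegative, as monotonicity of powers requires.
-seq≤suc : ∀ x → Eventually (λ n → ℚ.- seq x n ℚ.≤ ι (suc n))
-seq≤suc x =
  let C , b = CauchyLemmas.bounded (cauchy x)
      N , h = b and after C
  in N , λ n N≤n → ℚₚ.≤-trans (p≤∣p∣ (ℚ.- seq x n)) (ℚₚ.≤-trans (ℚₚ.≤-reflexive (ℚₚ.∣-p∣≡∣p∣ (seq x n)))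
    (ℚₚ.≤-trans (proj₁ (h n N≤n)) (ι-mono (ℕₚ.m≤n⇒m≤1+n (proj₂ (h n N≤n))))))

-- Comparing the sequences themselves, rather than assuming `x ≤ y`, lets `compound-mono` act index
-- by index, with no continuity estimate for `exp`.
exp-mono : ∀ {x y} → Eventually (λ n → seq x n ℚ.≤ seq y n) → exp x ≤ exp y
exp-mono {x} x≤y = let N , h = -seq≤suc x and x≤y in
  eventually-≤ (N , λ n N≤n → compound-mono n (proj₁ (h n N≤n)) (proj₂ (h n N≤n)))

0≤exp : ∀ x → 0ℝ ≤ exp x
0≤exp x = let N , h = -seq≤suc x in eventually-≤ (N , λ n N≤n → 0≤^ (suc n) (0≤1+step n (h n N≤n)))

exp-zero : ∀ {x} → x ≐ 0ℝ → exp x ≐ 1ℝ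
exp-zero x≐0 n = trans (cong (λ q → (1ℚ ℚ.+ q ℚ.* 1/suc n) ^ suc n) (x≐0 n))
  (trans (cong (_^ suc n) (solve 1 (λ u → con 1ℚ :+ con 0ℚ :* u := con 1ℚ) refl (1/suc n))) (1^n (suc n)))

x*0≐0 : ∀ x → - (x * fromℕ 0) ≐ 0ℝ
x*0≐0 x n = solve 1 (λ x → :- (x :* con 0ℚ) := con 0ℚ) refl (seq x n)

eventually-nonneg : ∀ {x} → 0ℝ < x → Eventually (λ n → 0ℚ ℚ.≤ seq x n)
eventually-nonneg 0<x = let N , h = eventually-gap 0<x in
  N , λ n N≤n → ℚₚ.≤-trans (ℚₚ.<⇒≤ (_<_.0<gap 0<x)) (h n N≤n)

exp[-x*k]-antitone : ∀ {x} → 0ℝ < x → ∀ j k → j ℕ.≤ k → exp (- (x * fromℕ k)) ≤ exp (- (x * fromℕ j))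
exp[-x*k]-antitone 0<x j k j≤k = let N , h = eventually-nonneg 0<x in
  exp-mono (N , λ n N≤n → ℚₚ.neg-antimono-≤ (*-monoˡ (h n N≤n) (ι-mono {j} {k} j≤k)))

exp[-x*k]≤1 : ∀ {x} → 0ℝ < x → ∀ k → exp (- (x * fromℕ k)) ≤ 1ℝ
exp[-x*k]≤1 {x} 0<x k = ≤-trans (exp[-x*k]-antitone 0<x 0 k ℕ.z≤n) (≐⇒≤ (exp-zero { - (x * fromℕ 0)} (x*0≐0 x)))

1≤exp : ∀ {x} → 0ℝ < x → 1ℝ ≤ exp x
1≤exp {x} 0<x = ≤-trans (≐⇒≤ (λ n → sym (exp-zero {0ℝ} (λ _ → refl) n))) (exp-mono {0ℝ} {x} (eventually-nonneg 0<x))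

geometric-nonneg : ∀ {θ} → 0ℝ < θ → ∀ k → 0ℝ ≤ geometric θ k
geometric-nonneg 0<θ k = x≤y⇒0≤y-x (exp[-x*k]-antitone 0<θ k (suc k) (ℕₚ.n≤1+n k))

geometric-zero : ∀ θ → geometric θ 0 ≐ 1ℝ - exp (- θ)
geometric-zero θ n = cong₂ ℚ._-_ (exp-zero { - (θ * fromℕ 0)} (x*0≐0 θ) n)
  (cong (λ q → compound (ℚ.- q) n) (ℚₚ.*-identityʳ (seq θ n)))

-- Series

partialSum-mono : ∀ {f} → (∀ k → 0ℝ ≤ f k) → ∀ {m n} → m ℕ.≤′ n → partialSum f m ≤ partialSum f n
partialSum-mono 0≤f ℕ.≤′-refl = ≤-refl
partialSum-mono {f} 0≤f {m} {suc n} (ℕ.≤′-step m≤n) = begin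
  partialSum f m          ≲⟨ partialSum-mono 0≤f m≤n ⟩
  partialSum f n          ≈⟨ (λ i → sym (ℚₚ.+-identityʳ (seq (partialSum f n) i))) ⟩
  partialSum f n + 0ℝ     ≲⟨ +-mono-≤ ≤-refl (0≤f n) ⟩
  partialSum f n + f n    ∎
  where open ≤-Reasoning

0<fromℚ : ∀ {q} → 0ℚ ℚ.< q → 0ℝ < fromℚ q
0<fromℚ {q} 0<q = *<* q 0<q (0 , λ _ _ → ℚₚ.≤-reflexive (ℚₚ.+-identityˡ q))

-- The partial sum up to m is at most a later one, taken past the convergence index for ε/2; the
-- other ε/2 pays for the comparison of the sequences.
partialSum≤sum : ∀ {f s} → (∀ k → 0ℝ ≤ f k) → f sumsTo s → ∀ m → partialSum f m ≤ s
partialSum≤sum {f} {s} 0≤f sums m = *≤* λ ε 0<ε →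
  let half-ε = ε ℚ.* ℚ.½
      N , h = sums (fromℚ half-ε) (0<fromℚ (0<half 0<ε))
      upper = ≤-trans (partialSum-mono 0≤f (ℕₚ.≤⇒≤′ (ℕₚ.m≤m⊔n m N))) (<⇒≤ (proj₂ (h (m ℕ.⊔ N) (ℕₚ.m≤n⊔m m N))))
      K , below = _≤_.below upper half-ε (0<half 0<ε)
  in K , λ n K≤n → ℚₚ.≤-trans (below n K≤n) (ℚₚ.≤-reflexive
    (solve 2 (λ s e → (s :+ e :* con ℚ.½) :+ e :* con ℚ.½ := s :+ e) refl (seq s n) ε))

head≤sum : ∀ {f s} → (∀ k → 0ℝ ≤ f k) → f sumsTo s → f 0 ≤ s
head≤sum {f} 0≤f sums = ≤-trans (≐⇒≤ (λ n → sym (ℚₚ.+-identityˡ (seq (f 0) n)))) (partialSum≤sum 0≤f sums 1)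

-- Expectations

-- Integrating real functions instead of events lets a bind be evaluated one stage at a time,
-- through `Ex-bind`.
Ex : ∀ {A : Set} → Dist A → (A → ℝ) → ℝ
Ex d h = sumℝ (map (λ (w , a) → w * h a) d)

indicator : ∀ {A : Set} → (A → Bool) → A → ℝ
indicator event a = if event a then 1ℝ else 0ℝ

module _ {A : Set} where

  Pr≐Ex : ∀ (d : Dist A) event → Pr d event ≐ Ex d (indicator event)
  Pr≐Ex []            event n = refl
  Pr≐Ex ((w , a) ∷ d) event n with event a
  ... | true  = cong₂ ℚ._+_ (sym (ℚₚ.*-identityʳ (seq w n))) (Pr≐Ex d event n)
  ... | false = cong₂ ℚ._+_ (sym (ℚₚ.*-zeroʳ (seq w n))) (Pr≐Ex d event n)

  Ex-++ : ∀ (d d′ : Dist A) h → Ex (d ++ d′) h ≐ Ex d h + Ex d′ h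
  Ex-++ []            d′ h n = sym (ℚₚ.+-identityˡ (seq (Ex d′ h) n))
  Ex-++ ((w , a) ∷ d) d′ h n = trans (cong (seq (w * h a) n ℚ.+_) (Ex-++ d d′ h n))
    (sym (ℚₚ.+-assoc (seq (w * h a) n) (seq (Ex d h) n) (seq (Ex d′ h) n)))

  Ex-scale : ∀ w (d : Dist A) h → Ex (map (λ (v , b) → w * v , b) d) h ≐ w * Ex d h
  Ex-scale w []            h n = sym (ℚₚ.*-zeroʳ (seq w n))
  Ex-scale w ((v , b) ∷ d) h n = trans (cong (seq (w * v * h b) n ℚ.+_) (Ex-scale w d h n))
    (solve 4 (λ w v b e → w :* v :* b :+ w :* e := w :* (v :* b :+ e)) refl (seq w n) (seq v n) (seq (h b) n) (seq (Ex d h) n))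

  Ex-bind : ∀ {B : Set} (d : Dist B) (f : B → Dist A) h → Ex (d >>= f) h ≐ Ex d (λ b → Ex (f b) h)
  Ex-bind []            f h n = refl
  Ex-bind ((w , b) ∷ d) f h n = trans (Ex-++ (map (λ (v , b) → w * v , b) (f b)) (d >>= f) h n)
    (cong₂ ℚ._+_ (Ex-scale w (f b) h n) (Ex-bind d f h n))

  -- The left side is the form to which a bind over the two-point `bernoulli` reduces; the final
  -- `[]` ends the concatenation.
  Ex-mixture : ∀ w v (d d′ : Dist A) h →
    Ex (map (λ (u , b) → w * u , b) d ++ map (λ (u , b) → v * u , b) d′ ++ []) h ≐ w * Ex d h + v * Ex d′ h
  Ex-mixture w v d d′ h n = trans (Ex-++ wd (vd′ ++ []) h n) (cong₂ ℚ._+_ (Ex-scale w d h n)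
    (trans (Ex-++ vd′ [] h n) (trans (ℚₚ.+-identityʳ (seq (Ex vd′ h) n)) (Ex-scale v d′ h n))))
    where
    wd  = map (λ (u , b) → w * u , b) d
    vd′ = map (λ (u , b) → v * u , b) d′

  Ex-nonneg : ∀ {d : Dist A} {h} → All (λ (w , _) → 0ℝ ≤ w) d → (∀ a → 0ℝ ≤ h a) → 0ℝ ≤ Ex d h
  Ex-nonneg []         0≤h = ≤-refl
  Ex-nonneg (0≤w ∷ ws) 0≤h = 0≤x+y (0≤x*y 0≤w (0≤h _)) (Ex-nonneg ws 0≤h)

  indicator-nonneg : ∀ (event : A → Bool) a → 0ℝ ≤ indicator event a
  indicator-nonneg event a with event a
  ... | true  = <⇒≤ (0<fromℕ {1} (ℕ.s≤s ℕ.z≤n))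
  ... | false = ≤-refl

  uniform-nonneg : ∀ (a : A) as → All (λ (w , _) → 0ℝ ≤ w) (uniform a as)
  uniform-nonneg a as = constant-weight (pointwise-≤ (λ _ → 0≤1/suc (length as))) (a ∷ as)
    where
    constant-weight : ∀ {u} → 0ℝ ≤ u → ∀ bs → All (λ ((w , _) : ℝ × A) → 0ℝ ≤ w) (map (u ,_) bs)
    constant-weight 0≤u []       = []
    constant-weight 0≤u (b ∷ bs) = 0≤u ∷ constant-weight 0≤u bs

  -- The weight `u` is kept free because in `uniform` it depends on the length of the whole list,
  -- whereas the induction shortens the list.
  Ex-uniform : ∀ u (bs : List A) (event : A → Bool) →
    Ex (map (u ,_) bs) (indicator event) ≐ fromℕ (length (filterᵇ event bs)) * u
  Ex-uniform u []       event n = sym (ℚₚ.*-zeroˡ (seq u n))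
  Ex-uniform u (b ∷ bs) event n with event b
  ... | true  = trans (cong (seq u n ℚ.* 1ℚ ℚ.+_) (Ex-uniform u bs event n)) (trans
    (solve 2 (λ u i → u :* con 1ℚ :+ i :* u := (con 1ℚ :+ i) :* u) refl (seq u n) (ι (length (filterᵇ event bs))))
    (cong (ℚ._* seq u n) (sym (ι-suc (length (filterᵇ event bs))))))
  ... | false = trans (cong (seq u n ℚ.* 0ℚ ℚ.+_) (Ex-uniform u bs event n))
    (solve 2 (λ u i → u :* con 0ℚ :+ i :* u := i :* u) refl (seq u n) (ι (length (filterᵇ event bs))))

-- Selection, the recursion of the run, and its undropped term

module _ {T : ℕ} (rule : SelectionRule T) where

  open SelectionRule rule

  -- The branching of `select` sits in a local function; restating it as equations lets later proofs
  -- split on it without repeating the `with`.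
  select-cases : ∀ S →
    (filterᵇ isPositive S ≡ [] × select S ≡ fallback S) ⊎
    (∃₂ λ o os → filterᵇ isPositive S ≡ o ∷ os × select S ≡ uniform o os)
  select-cases S with filterᵇ isPositive S
  ... | []     = inj₁ (refl , refl)
  ... | o ∷ os = inj₂ (o , os , refl , refl)

  select-nonneg : ∀ {S} → nothing ∈ S → All (λ ((w , _) : ℝ × Output T) → 0ℝ ≤ w) (select S)
  select-nonneg {S} ⊥∈S = [ from-fallback , from-uniform ]′ (select-cases S)
    where
    NonNeg : Dist (Output T) → Set
    NonNeg = All (λ (w , _) → 0ℝ ≤ w)
    from-fallback : filterᵇ isPositive S ≡ [] × select S ≡ fallback S → NonNeg (select S)
    from-fallback (_ , e) = subst NonNeg (sym e) (proj₁ (fallback-isDistribution S ⊥∈S))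
    from-uniform : (∃₂ λ o os → filterᵇ isPositive S ≡ o ∷ os × select S ≡ uniform o os) → NonNeg (select S)
    from-uniform (o , os , _ , e) = subst NonNeg (sym e) (uniform-nonneg o os)

  module _ {Dataset : Set} (ε₁ θ : ℝ) (M : Fin T → Mechanism Dataset) (X : Dataset) where

    open Algorithm rule ε₁ θ M X

    Ex-process : ∀ k t ts S h → let e = exp (- (ε₁ * fromℕ k)) in Ex (process k (t ∷ ts) S) h ≐
      e * Ex (Mechanism.run (M t) X) (λ o → Ex (process k ts (just (o , t) ∷ S)) h) + (1ℝ - e) * Ex (process k ts S) h
    Ex-process k t ts S h n = trans
      (Ex-mixture e (1ℝ - e) (Mechanism.run (M t) X >>= λ o → process k ts (just (o , t) ∷ S)) (process k ts S) h n)
      (cong (λ z → seq e n ℚ.* z ℚ.+ seq (1ℝ - e) n ℚ.* seq (Ex (process k ts S) h) n)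
        (Ex-bind (Mechanism.run (M t) X) (λ o → process k ts (just (o , t) ∷ S)) h n))
      where e = exp (- (ε₁ * fromℕ k))

    -- Stated for every `k`, so that the terms k ≥ 1 of the series can be discarded. The fallback is
    -- a distribution only when ⊥ is in `S`, hence the restricted assumption on `h`; adding outputs
    -- preserves membership of ⊥.
    process-nonneg : 0ℝ < ε₁ → ∀ k ts {S h} → nothing ∈ S → (∀ {S} → nothing ∈ S → 0ℝ ≤ h S) →
      0ℝ ≤ Ex (process k ts S) h
    process-nonneg 0<ε₁ k []       {S} {h} ⊥∈S 0≤h = ≤-trans (0≤h ⊥∈S)
      (≐⇒≤ (λ n → solve 1 (λ x → x := con 1ℚ :* x :+ con 0ℚ) refl (seq (h S) n)))
    process-nonneg 0<ε₁ k (t ∷ ts) {S} {h} ⊥∈S 0≤h = begin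
      0ℝ                                ≲⟨ 0≤x+y
        (0≤x*y (0≤exp _) (Ex-nonneg (proj₁ (Mechanism.isDistribution (M t) X))
          (λ o → process-nonneg 0<ε₁ k ts {just (o , t) ∷ S} (there ⊥∈S) 0≤h)))
        (0≤x*y (x≤y⇒0≤y-x (exp[-x*k]≤1 0<ε₁ k)) (process-nonneg 0<ε₁ k ts ⊥∈S 0≤h)) ⟩
      e * Ex (Mechanism.run (M t) X) (λ o → Ex (process k ts (just (o , t) ∷ S)) h)
        + (1ℝ - e) * Ex (process k ts S) h  ≈⟨ Ex-process k t ts S h ⟨
      Ex (process k (t ∷ ts) S) h       ∎
      where
      open ≤-Reasoning
      e = exp (- (ε₁ * fromℕ k))

    run-mass≤ : 0ℝ < ε₁ → 0ℝ < θ → ∀ {event P} → HasProbability event P →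
      (1ℝ - exp (- θ)) * Ex (process 0 (allFin T) (nothing ∷ [])) (λ S → Ex (select S) (indicator event)) ≤ P
    run-mass≤ 0<ε₁ 0<θ {event} sums = ≤-trans
      (≐⇒≤ (λ n → cong₂ ℚ._*_ (sym (geometric-zero θ n)) (sym (Pr-runWith 0 n))))
      (head≤sum (λ k → 0≤x*y (geometric-nonneg 0<θ k) (≤-trans
        (process-nonneg 0<ε₁ k (allFin T) (here refl) (λ ⊥∈S → Ex-nonneg (select-nonneg ⊥∈S) (indicator-nonneg event)))
        (≐⇒≤ (λ n → sym (Pr-runWith k n))))) sums)
      where
      Pr-runWith : ∀ k → Pr (runWith k) event ≐
        Ex (process k (allFin T) (nothing ∷ [])) (λ S → Ex (select S) (indicator event))
      Pr-runWith k n = trans (Pr≐Ex (runWith k) event n)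
        (Ex-bind (process k (allFin T) (nothing ∷ [])) select (indicator event) n)

-- Coins

module _ (p : ℝ) (0≤p : 0ℝ ≤ p) (p≤1 : p ≤ 1ℝ) where

  coin : ∀ {Dataset : Set} → Mechanism Dataset
  coin = record
    { run            = λ _ → (p , Sign.+) ∷ (1ℝ - p , Sign.-) ∷ []
    ; isDistribution = λ _ → 0≤p ∷ x≤y⇒0≤y-x p≤1 ∷ [] ,
        ≐⇒≈ (λ n → solve 1 (λ p → p :+ ((con 1ℚ :- p) :+ con 0ℚ) := con 1ℚ) refl (seq p n))
    }

  module _ {Dataset : Set} where

    open Mechanism (coin {Dataset})

    success-coin : ∀ X → success X ≐ p
    success-coin X n = solve 1 (λ p → p :+ (con 0ℚ :+ con 0ℚ) := p) refl (seq p n)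

    -- The output law ignores the dataset, so the two probabilities coincide and 1 ≤ e^{ε₁}
    -- suffices.
    coin-isDP : ∀ {_~_} {ε₁} → 0ℝ < ε₁ → IsDP _~_ ε₁
    coin-isDP {_~_} {ε₁} 0<ε₁ {X} {X′} _ v = begin
      probability X v                 ≈⟨ (λ n → sym (ℚₚ.*-identityʳ _)) ⟩
      probability X v * 1ℝ            ≲⟨ *-monoʳ-≤ 0≤probability (1≤exp 0<ε₁) ⟩
      probability X v * exp ε₁        ≈⟨ (λ n → ℚₚ.*-comm (seq (probability X v) n) (seq (exp ε₁) n)) ⟩
      exp ε₁ * probability X′ v       ∎
      where
      open ≤-Reasoning
      event : Sign → Bool
      event o = does (o Signₚ.≟ v)
      0≤probability : 0ℝ ≤ probability X v
      0≤probability = ≤-trans (Ex-nonneg (proj₁ (isDistribution X)) (indicator-nonneg event))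
        (≐⇒≤ (λ n → sym (Pr≐Ex (run X) event n)))

-- Counting

length-filterᵇ-mono : ∀ {A : Set} (P Q : A → Bool) → (∀ a → P a ≡ true → Q a ≡ true) →
  ∀ as → length (filterᵇ P as) ℕ.≤ length (filterᵇ Q as)
length-filterᵇ-mono P Q P⇒Q []       = ℕ.z≤n
length-filterᵇ-mono P Q P⇒Q (a ∷ as) with P a in Pa | Q a in Qa
... | true  | true  = ℕ.s≤s (length-filterᵇ-mono P Q P⇒Q as)
... | false | true  = ℕₚ.m≤n⇒m≤1+n (length-filterᵇ-mono P Q P⇒Q as)
... | false | false = length-filterᵇ-mono P Q P⇒Q as
... | true  | false with () ← trans (sym (P⇒Q a Pa)) Qa

-- Bad outputs are counted in all of `S`, while selection draws from its positive part; this equates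
-- the two counts.
filterᵇ-filterᵇ : ∀ {A : Set} (P Q : A → Bool) → (∀ a → P a ≡ true → Q a ≡ true) →
  ∀ as → filterᵇ P (filterᵇ Q as) ≡ filterᵇ P as
filterᵇ-filterᵇ P Q P⇒Q []       = refl
filterᵇ-filterᵇ P Q P⇒Q (a ∷ as) with Q a in Qa
... | true  with P a
...   | true  = cong (a ∷_) (filterᵇ-filterᵇ P Q P⇒Q as)
...   | false = filterᵇ-filterᵇ P Q P⇒Q as
filterᵇ-filterᵇ P Q P⇒Q (a ∷ as) | false with P a in Pa
...   | true  with () ← trans (sym (P⇒Q a Pa)) Qa
...   | false = filterᵇ-filterᵇ P Q P⇒Q as

length-filterᵇ-tabulate : ∀ {A : Set} {n} (P : A → Bool) (f : Fin n → A) (s : Subset n) →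
  (∀ i → P (f i) ≡ lookup s i) → length (filterᵇ P (tabulate f)) ≡ ∣ s ∣
length-filterᵇ-tabulate P f []      h = refl
length-filterᵇ-tabulate P f (b ∷ s) h with P (f zero) | h zero
... | true  | refl = cong suc (length-filterᵇ-tabulate P (λ i → f (suc i)) s (λ i → h (suc i)))
... | false | refl = length-filterᵇ-tabulate P (λ i → f (suc i)) s (λ i → h (suc i))

bit : Bool → ℕ
bit b = if b then 1 else 0

-- Turns the branch inside `filterᵇ` into an addend, so that one case split on a Boolean can act on
-- several counts at once.
length-filterᵇ-∷ : ∀ {A : Set} (P : A → Bool) a as → length (filterᵇ P (a ∷ as)) ≡ bit (P a) ℕ.+ length (filterᵇ P as)
length-filterᵇ-∷ P a as with P a
... | true  = refl
... | false = refl

-- The quadratic lower bound and its behaviour under one toss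

-- At μ = ν = 0 this is 2cx - c²xm, at most x/m for m ≥ 1.  The other terms account
-- for coins still to be tossed, of expected counts μ (low) and ν (good); E[N_B²] is
-- replaced by its upper bound μ + μ².
value : (c μ ν x m : ℝ) → ℝ
value c μ ν x m = fromℕ 2 * c * (x + μ) - c * c * ((x + μ) * (m + (μ + ν)) + μ)

value-cong : ∀ c {μ μ′ ν ν′ x x′ m m′} → μ ≐ μ′ → ν ≐ ν′ → x ≐ x′ → m ≐ m′ →
  value c μ ν x m ≐ value c μ′ ν′ x′ m′
value-cong c {μ} {μ′} {ν} {ν′} {x} {x′} {m} {m′} e₁ e₂ e₃ e₄ n
  rewrite e₁ n | e₂ n | e₃ n | e₄ n = refl

-- The slack is exactly (cp)²: a low coin has variance p(1 - p), but `value` charges p for it.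
value-low : ∀ c p μ ν x m {μ′ x′ m′} → μ′ ≐ p + μ → x′ ≐ 1ℝ + x → m′ ≐ 1ℝ + m →
  value c μ′ ν x m ≤ p * value c μ ν x′ m′ + (1ℝ - p) * value c μ ν x m
value-low c p μ ν x m {μ′} {x′} {m′} eμ ex em = pointwise-≤ below
  where
  below : ∀ n → seq (value c μ′ ν x m) n ℚ.≤ seq (p * value c μ ν x′ m′ + (1ℝ - p) * value c μ ν x m) n
  below n rewrite eμ n | ex n | em n = 0≤-⇒≤ (subst (0ℚ ℚ.≤_) (solve 6
    (λ c p μ ν x m →
      let val = λ μ ν x m → con (ι 2) :* c :* (x :+ μ) :- c :* c :* ((x :+ μ) :* (m :+ (μ :+ ν)) :+ μ) in
      (c :* p) :* (c :* p) :=
      (p :* val μ ν (con 1ℚ :+ x) (con 1ℚ :+ m) :+ (con 1ℚ :- p) :* val μ ν x m) :- val (p :+ μ) ν x m)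
    refl (seq c n) (seq p n) (seq μ n) (seq ν n) (seq x n) (seq m n)) (0≤sq (seq c n ℚ.* seq p n)))

-- Exact, because `value` is affine in `m` and depends on `m` and `ν` only through their sum.
value-good : ∀ c p μ ν x m {ν′ m′} → ν′ ≐ p + ν → m′ ≐ 1ℝ + m →
  value c μ ν′ x m ≐ p * value c μ ν x m′ + (1ℝ - p) * value c μ ν x m
value-good c p μ ν x m eν em n rewrite eν n | em n = solve 6
  (λ c p μ ν x m →
    let val = λ μ ν x m → con (ι 2) :* c :* (x :+ μ) :- c :* c :* ((x :+ μ) :* (m :+ (μ :+ ν)) :+ μ) in
    val μ (p :+ ν) x m := (p :* val μ ν x (con 1ℚ :+ m) :+ (con 1ℚ :- p) :* val μ ν x m))
  refl (seq c n) (seq p n) (seq μ n) (seq ν n) (seq x n) (seq m n)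

-- The tangent inequality for 1/m, scaled by x: with m = k + 1 the difference of the two sides is
-- (x/m)(1 - cm)².
value-ratio : ∀ c x k → value c 0ℝ 0ℝ (fromℕ x) (fromℕ (suc k)) ≤ fromℕ x * fromℚ (1/suc k)
value-ratio c x k = pointwise-≤ λ n → 0≤-⇒≤ (subst (0ℚ ℚ.≤_) (eq n)
  (0≤* (0≤* (0≤ι x) (0≤1/suc k)) (0≤sq (1ℚ ℚ.- seq c n ℚ.* ι (suc k)))))
  where
  eq : ∀ n → let c′ = seq c n; s = 1ℚ ℚ.- c′ ℚ.* ι (suc k) in
    (ι x ℚ.* 1/suc k) ℚ.* (s ℚ.* s) ≡ ι x ℚ.* 1/suc k ℚ.- seq (value c 0ℝ 0ℝ (fromℕ x) (fromℕ (suc k))) n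
  eq n = trans
    (solve 4 (λ c x m u → (x :* u) :* ((con 1ℚ :- c :* m) :* (con 1ℚ :- c :* m)) :=
        x :* u :- con (ι 2) :* c :* x :* (m :* u) :+ c :* c :* (x :* m) :* (m :* u))
      refl (seq c n) (ι x) (ι (suc k)) (1/suc k))
    (trans (cong (λ z → ι x ℚ.* 1/suc k ℚ.- ι 2 ℚ.* seq c n ℚ.* ι x ℚ.* z
                          ℚ.+ seq c n ℚ.* seq c n ℚ.* (ι x ℚ.* ι (suc k)) ℚ.* z) (ι*1/suc k))
      (solve 4 (λ c x m u → x :* u :- con (ι 2) :* c :* x :* con 1ℚ :+ c :* c :* (x :* m) :* con 1ℚ :=
          x :* u :- (con (ι 2) :* c :* (x :+ con 0ℚ) :- c :* c :* ((x :+ con 0ℚ) :* (m :+ (con 0ℚ :+ con 0ℚ)) :+ con 0ℚ)))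
        refl (seq c n) (ι x) (ι (suc k)) (1/suc k)))

value-none : ∀ c m → value c 0ℝ 0ℝ 0ℝ m ≐ 0ℝ
value-none c m n = solve 2 (λ c m → con (ι 2) :* c :* (con 0ℚ :+ con 0ℚ)
    :- c :* c :* ((con 0ℚ :+ con 0ℚ) :* (m :+ (con 0ℚ :+ con 0ℚ)) :+ con 0ℚ) := con 0ℚ)
  refl (seq c n) (seq m n)

-- Before any toss the form is 2cμ - c²(μ(μ + ν) + μ) = 2cμ - c²μa. With ca = 1 this equals cμ; the
-- 1 in a absorbs the variance term μ.
value-start : ∀ {μ ν} (0<a : 0ℝ < 1ℝ + (μ + ν)) → let c = inverse _ 0<a in μ * c ≤ value c μ ν 0ℝ 0ℝ
value-start {μ} {ν} 0<a = let N , h = inverse-inverts 0<a in eventually-≤ (N , λ n N≤n → ℚₚ.≤-reflexive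
  (let c = seq (inverse _ 0<a) n; a = 1ℚ ℚ.+ (seq μ n ℚ.+ seq ν n) in
  trans (solve 2 (λ μ c → μ :* c := con (ι 2) :* c :* μ :- c :* μ :* con 1ℚ) refl (seq μ n) c)
  (trans (cong (λ z → ι 2 ℚ.* c ℚ.* seq μ n ℚ.- c ℚ.* seq μ n ℚ.* z) (sym (h n N≤n)))
    (solve 3 (λ μ ν c → con (ι 2) :* c :* μ :- c :* μ :* ((con 1ℚ :+ (μ :+ ν)) :* c) :=
      con (ι 2) :* c :* (con 0ℚ :+ μ) :- c :* c :* ((con 0ℚ :+ μ) :* (con 0ℚ :+ (μ :+ ν)) :+ μ))
      refl (seq μ n) (seq ν n) c))))

fromℕ-suc-* : ∀ k p → fromℕ (suc k) * p ≐ p + fromℕ k * p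
fromℕ-suc-* k p n = trans (cong (ℚ._* seq p n) (ι-suc k))
  (solve 2 (λ k p → (con 1ℚ :+ k) :* p := p :+ k :* p) refl (ι k) (seq p n))

-- The undropped run on independent coins

module CoinFamily {T : ℕ} (rule : SelectionRule T) (good : Subset T)
  (rate : Bool → ℝ) (0≤rate : ∀ b → 0ℝ ≤ rate b) (rate≤1 : ∀ b → rate b ≤ 1ℝ) where

  open SelectionRule rule

  -- The part of the low event fixed by `good` alone. If p* ≤ p̄, good coins may be low too, so
  -- later only the implication from `isBad` to the event is assumed.
  isBad : Output T → Bool
  isBad (just (Sign.+ , t)) = not (lookup good t)
  isBad _                   = false

  isBad⇒isPositive : ∀ o → isBad o ≡ true → isPositive o ≡ true
  isBad⇒isPositive (just (Sign.+ , t)) _ = refl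

  coins : ∀ {Dataset : Set} → Fin T → Mechanism Dataset
  coins t = coin (rate (lookup good t)) (0≤rate _) (rate≤1 _)

  bads positives : List (Output T) → ℝ
  bads S      = fromℕ (length (filterᵇ isBad S))
  positives S = fromℕ (length (filterᵇ isPositive S))

  expectedBads expectedGoods : List (Fin T) → ℝ
  expectedBads ts  = fromℕ (length (filterᵇ (λ t → not (lookup good t)) ts)) * rate false
  expectedGoods ts = fromℕ (length (filterᵇ (lookup good) ts)) * rate true

  -- A potential for the state with `ts` still to be tossed and `S` collected; by `valueAt-step` it
  -- is a submartingale along the undropped run.
  valueAt : ℝ → List (Fin T) → List (Output T) → ℝ
  valueAt c ts S = value c (expectedBads ts) (expectedGoods ts) (bads S) (positives S)

  valueAt-step : ∀ c t ts S → let p = rate (lookup good t) in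
    valueAt c (t ∷ ts) S ≤ p * valueAt c ts (just (Sign.+ , t) ∷ S) + (1ℝ - p) * valueAt c ts S
  -- All counts that depend on whether `t` is good are first written with `bit`, so that `step` can
  -- split on that Boolean everywhere simultaneously.
  valueAt-step c t ts S = subst₂
    (λ (b , g) x → value c (fromℕ b * rate false) (fromℕ g * rate true) (bads S) (positives S) ≤
      p * value c (expectedBads ts) (expectedGoods ts) (fromℕ x) (fromℕ (suc k)) + (1ℝ - p) * valueAt c ts S)
    (cong₂ _,_ (sym (length-filterᵇ-∷ (λ t → not (lookup good t)) t ts)) (sym (length-filterᵇ-∷ (lookup good) t ts)))
    (sym (length-filterᵇ-∷ isBad (just (Sign.+ , t)) S))
    (step (lookup good t))
    where
    p = rate (lookup good t)
    b = length (filterᵇ (λ t → not (lookup good t)) ts)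
    g = length (filterᵇ (lookup good) ts)
    j = length (filterᵇ isBad S)
    k = length (filterᵇ isPositive S)
    step : ∀ s → let p = rate s in
      value c (fromℕ (bit (not s) ℕ.+ b) * rate false) (fromℕ (bit s ℕ.+ g) * rate true) (fromℕ j) (fromℕ k) ≤
      p * value c (fromℕ b * rate false) (fromℕ g * rate true) (fromℕ (bit (not s) ℕ.+ j)) (fromℕ (suc k))
        + (1ℝ - p) * value c (fromℕ b * rate false) (fromℕ g * rate true) (fromℕ j) (fromℕ k)
    step true  = ≐⇒≤ (value-good c (rate true) (fromℕ b * rate false) (fromℕ g * rate true) (fromℕ j) (fromℕ k)
      {fromℕ (suc g) * rate true} {fromℕ (suc k)} (fromℕ-suc-* g (rate true)) (λ _ → ι-suc k))
    step false = value-low c (rate false) (fromℕ b * rate false) (fromℕ g * rate true) (fromℕ j) (fromℕ k)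
      {fromℕ (suc b) * rate false} {fromℕ (suc j)} {fromℕ (suc k)}
      (fromℕ-suc-* b (rate false)) (λ _ → ι-suc j) (λ _ → ι-suc k)

  module _ (event : Output T → Bool) (isBad⇒event : ∀ o → isBad o ≡ true → event o ≡ true) where

    payoff : List (Output T) → ℝ
    payoff S = Ex (select S) (indicator event)

    -- If `S` has positives, the event has probability at least the fraction of bad ones among them,
    -- and `value-ratio` applies. Otherwise the form vanishes and nonnegativity of the payoff is
    -- enough.
    select-bound : ∀ c {S} → nothing ∈ S → value c 0ℝ 0ℝ (bads S) (positives S) ≤ payoff S
    select-bound c {S} ⊥∈S = [ no-positives , some-positive ]′ (select-cases rule S)
      where
      open ≤-Reasoning
      no-positives : filterᵇ isPositive S ≡ [] × select S ≡ fallback S → value c 0ℝ 0ℝ (bads S) (positives S) ≤ payoff S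
      no-positives (none , _) = begin
        value c 0ℝ 0ℝ (bads S) (positives S)  ≈⟨ value-cong c {0ℝ} {0ℝ} {0ℝ} {0ℝ}
          {bads S} {0ℝ} {positives S} {positives S} (λ _ → refl) (λ _ → refl) (λ _ → cong ι no-bads) (λ _ → refl) ⟩
        value c 0ℝ 0ℝ 0ℝ (positives S)        ≈⟨ value-none c (positives S) ⟩
        0ℝ                                    ≲⟨ Ex-nonneg (select-nonneg rule ⊥∈S) (indicator-nonneg event) ⟩
        payoff S                              ∎
        where
        no-bads : length (filterᵇ isBad S) ≡ 0
        no-bads = cong length (trans (sym (filterᵇ-filterᵇ isBad isPositive isBad⇒isPositive S)) (cong (filterᵇ isBad) none))
      some-positive : (∃₂ λ o os → filterᵇ isPositive S ≡ o ∷ os × select S ≡ uniform o os) →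
        value c 0ℝ 0ℝ (bads S) (positives S) ≤ payoff S
      some-positive (o , os , some , e) = begin
        value c 0ℝ 0ℝ (bads S) (positives S)               ≈⟨ value-cong c {0ℝ} {0ℝ} {0ℝ} {0ℝ}
          {bads S} {bads S} {positives S} {fromℕ (suc (length os))} (λ _ → refl) (λ _ → refl) (λ _ → refl) (λ _ → cong ι (cong length some)) ⟩
        value c 0ℝ 0ℝ (bads S) (fromℕ (suc (length os)))   ≲⟨ value-ratio c (length (filterᵇ isBad S)) (length os) ⟩
        bads S * fromℚ u                                   ≲⟨ pointwise-≤ (λ _ → *-monoʳ (0≤1/suc (length os)) (ι-mono bads≤)) ⟩
        fromℕ (length (filterᵇ event (o ∷ os))) * fromℚ u  ≈⟨ Ex-uniform (fromℚ u) (o ∷ os) event ⟨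
        Ex (uniform o os) (indicator event)                ≈⟨ (λ n → cong (λ d → seq (Ex d (indicator event)) n) (sym e)) ⟩
        payoff S                                           ∎
        where
        u = 1/suc (length os)
        bads≤ : length (filterᵇ isBad S) ℕ.≤ length (filterᵇ event (o ∷ os))
        bads≤ = subst (ℕ._≤ length (filterᵇ event (o ∷ os)))
          (cong length (trans (cong (filterᵇ isBad) (sym some)) (filterᵇ-filterᵇ isBad isPositive isBad⇒isPositive S)))
          (length-filterᵇ-mono isBad event isBad⇒event (o ∷ os))

    module _ {Dataset : Set} (ε₁ θ : ℝ) (X : Dataset) where

      open Algorithm rule ε₁ θ coins X

      -- At k = 0 the keep probability is e⁰ = 1, so the dropping branch has weight 0.
      Ex-process-undropped : ∀ t ts S → let p = rate (lookup good t) in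
        Ex (process 0 (t ∷ ts) S) payoff ≐
        p * Ex (process 0 ts (just (Sign.+ , t) ∷ S)) payoff
          + (1ℝ - p) * Ex (process 0 ts (just (Sign.- , t) ∷ S)) payoff
      Ex-process-undropped t ts S n = trans (Ex-process rule ε₁ θ coins X 0 t ts S payoff n)
        (trans (cong (λ e → e ℚ.* (seq p n ℚ.* seq K₊ n ℚ.+ ((1ℚ ℚ.- seq p n) ℚ.* seq K₋ n ℚ.+ 0ℚ))
                            ℚ.+ (1ℚ ℚ.- e) ℚ.* seq K n)
          (exp-zero { - (ε₁ * fromℕ 0)} (x*0≐0 ε₁) n))
          (solve 4 (λ p a b k → con 1ℚ :* (p :* a :+ ((con 1ℚ :- p) :* b :+ con 0ℚ)) :+ (con 1ℚ :- con 1ℚ) :* k :=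
            p :* a :+ (con 1ℚ :- p) :* b) refl (seq p n) (seq K₊ n) (seq K₋ n) (seq K n)))
        where
        p = rate (lookup good t)
        K₊ = Ex (process 0 ts (just (Sign.+ , t) ∷ S)) payoff
        K₋ = Ex (process 0 ts (just (Sign.- , t) ∷ S)) payoff
        K  = Ex (process 0 ts S) payoff

      -- Induction on the remaining coins: `select-bound` handles the final set, `valueAt-step` each
      -- toss.
      process-bound : ∀ c ts {S} → nothing ∈ S → valueAt c ts S ≤ Ex (process 0 ts S) payoff
      process-bound c []       {S} ⊥∈S = begin
        valueAt c [] S                        ≈⟨ value-cong c {expectedBads []} {0ℝ} {expectedGoods []} {0ℝ} {bads S} {bads S} {positives S} {positives S}
          (λ n → ℚₚ.*-zeroˡ (seq (rate false) n)) (λ n → ℚₚ.*-zeroˡ (seq (rate true) n)) (λ _ → refl) (λ _ → refl) ⟩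
        value c 0ℝ 0ℝ (bads S) (positives S)  ≲⟨ select-bound c ⊥∈S ⟩
        payoff S                              ≈⟨ (λ n → solve 1 (λ x → x := con 1ℚ :* x :+ con 0ℚ) refl (seq (payoff S) n)) ⟩
        Ex (process 0 [] S) payoff            ∎
        where open ≤-Reasoning
      process-bound c (t ∷ ts) {S} ⊥∈S = begin
        valueAt c (t ∷ ts) S                      ≲⟨ valueAt-step c t ts S ⟩
        p * valueAt c ts (just (Sign.+ , t) ∷ S)
          + (1ℝ - p) * valueAt c ts S             ≲⟨ +-mono-≤
          (*-monoʳ-≤ (0≤rate _) (process-bound c ts {just (Sign.+ , t) ∷ S} (there ⊥∈S)))
          -- Both counts skip the added negative output, so the potential there is `valueAt c ts S`
          -- by computation.
          (*-monoʳ-≤ (x≤y⇒0≤y-x (rate≤1 _)) (process-bound c ts {just (Sign.- , t) ∷ S} (there ⊥∈S))) ⟩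
        p * Ex (process 0 ts (just (Sign.+ , t) ∷ S)) payoff
          + (1ℝ - p) * Ex (process 0 ts (just (Sign.- , t) ∷ S)) payoff  ≈⟨ Ex-process-undropped t ts S ⟨
        Ex (process 0 (t ∷ ts) S) payoff          ∎
        where
        open ≤-Reasoning
        p = rate (lookup good t)

      process-all-bound : ∀ c →
        value c (fromℕ (T ∸ ∣ good ∣) * rate false) (fromℕ ∣ good ∣ * rate true) 0ℝ 0ℝ ≤
        Ex (process 0 (allFin T) (nothing ∷ [])) payoff
      process-all-bound c = subst₂
        (λ b g → value c (fromℕ b * rate false) (fromℕ g * rate true) 0ℝ 0ℝ ≤
          Ex (process 0 (allFin T) (nothing ∷ [])) payoff)
        (trans (length-filterᵇ-tabulate (λ t → not (lookup good t)) (λ t → t) (∁ good)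
          (λ i → sym (Vecₚ.lookup-map i not good)))
          (Subsetₚ.∣∁p∣≡n∸∣p∣ good))
        (length-filterᵇ-tabulate (lookup good) (λ t → t) good (λ _ → refl))
        (process-bound c (allFin T) (here refl))

-- From the undropped run to the bound on the low rate

lookup-∉ : ∀ {n} {t : Fin n} (s : Subset n) → t Subset.∉ s → lookup s t ≡ false
lookup-∉ {t = t} s t∉s with lookup s t in e
... | true  = ⊥-elim (t∉s (Vecₚ.lookup⇒[]= t s e))
... | false = refl

mass-bound : ∀ {β D μ ν K} → 0ℝ ≤ D → 0ℝ ≤ μ → 0ℝ ≤ ν → β ≤ D * fromℚ ℚ.½ →
  (∀ c → value c μ ν 0ℝ 0ℝ ≤ K) → D * K ≤ β → D * μ ≤ fromℕ 2 * β * (1ℝ + ν)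
mass-bound {β} {D} {μ} {ν} {K} 0≤D 0≤μ 0≤ν β≤D/2 bound DK≤β = 0≤y-x⇒x≤y (begin
    -- The required difference is twice the sum of two nonnegative slacks, aβ - Dμ and μD/2 - μβ.
    0ℝ                                                        ≲⟨ 0≤x*y (pointwise-≤ {0ℝ} {fromℕ 2} (λ _ → 0≤ι 2))
      (0≤x+y (x≤y⇒0≤y-x Dμ≤aβ) (x≤y⇒0≤y-x (*-monoʳ-≤ 0≤μ β≤D/2))) ⟩
    fromℕ 2 * ((a * β - D * μ) + (μ * (D * fromℚ ℚ.½) - μ * β))  ≈⟨ (λ n → solve 4 (λ β D μ ν →
      con (ι 2) :* (((con 1ℚ :+ (μ :+ ν)) :* β :- D :* μ) :+ (μ :* (D :* con ℚ.½) :- μ :* β)) :=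
      con (ι 2) :* β :* (con 1ℚ :+ ν) :- D :* μ) refl (seq β n) (seq D n) (seq μ n) (seq ν n)) ⟩
    fromℕ 2 * β * (1ℝ + ν) - D * μ                            ∎)
  where
  open ≤-Reasoning
  a = 1ℝ + (μ + ν)
  0<a : 0ℝ < a
  0<a = 0<1+x (0≤x+y 0≤μ 0≤ν)
  c = inverse a 0<a
  Dμ≤aβ : D * μ ≤ a * β
  Dμ≤aβ = begin
    D * μ              ≲⟨ cancel-inverse (D * μ) 0<a ⟩
    a * (D * μ * c)    ≈⟨ (λ n → cong (seq a n ℚ.*_) (ℚₚ.*-assoc (seq D n) (seq μ n) (seq c n))) ⟩
    a * (D * (μ * c))  ≲⟨ *-monoʳ-≤ (<⇒≤ 0<a) (≤-trans (*-monoʳ-≤ 0≤D (≤-trans (value-start 0<a) (bound c))) DK≤β) ⟩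
    a * β              ∎

-- Kept free of division, so that the explicit bound and the asymptotic one both follow by dividing
-- in the appropriate order.
low-rate-bound : ∀ {ε₁ ε} → 0ℝ < ε₁ → fromℕ 2 * ε₁ < ε → (S : Setting ε₁ ε) → let open Setting S in
  LowOutputRare → p̄ * (fromℕ (T ∸ G) * (1ℝ - exp (- θ_G ε₁ ε))) ≤ fromℕ 2 * β * (1ℝ + fromℕ G * p*)
low-rate-bound {ε₁} {ε} 0<ε₁ 2ε₁<ε S rare =
  -- The coins at good indices may be low as well; the event must decide whether they are.
  ≤-stable λ ¬bound → ¬¬-excluded-middle {A = p* ≤ p̄} λ p*≤?p̄ → ¬bound
    (subst (λ g → p̄ * (fromℕ (T ∸ g) * D) ≤ fromℕ 2 * β * (1ℝ + fromℕ g * p*)) ∣good∣≡G (decided p*≤?p̄))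
  where
  open Setting S
  θ = θ_G ε₁ ε
  D = 1ℝ - exp (- θ)
  0<θ : 0ℝ < θ
  0<θ = x<y⇒0<y-x 2ε₁<ε
  rate : Bool → ℝ
  rate s = if s then p* else p̄
  0≤rate : ∀ s → 0ℝ ≤ rate s
  0≤rate true  = <⇒≤ 0<p*
  0≤rate false = 0≤p̄
  rate≤1 : ∀ s → rate s ≤ 1ℝ
  rate≤1 true  = <⇒≤ p*<1
  rate≤1 false = p̄≤1
  open CoinFamily rule good rate 0≤rate rate≤1
  success-coins : ∀ t {s} → lookup good t ≡ s → Mechanism.success (coins {Dataset} t) X ≐ rate s
  success-coins t refl = success-coin (rate (lookup good t)) (0≤rate _) (rate≤1 _) X
  admissible : Admissible coins
  admissible = record
    { isDP   = λ t → coin-isDP (rate (lookup good t)) (0≤rate _) (rate≤1 _) {_~_ = _~_} 0<ε₁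
    ; good-≥ = λ t t∈good → ≐⇒≤ (λ n → sym (success-coins t (Vecₚ.[]=⇒lookup t∈good) n))
    ; bad-≤  = λ t t∉good → ≐⇒≤ (success-coins t (lookup-∉ good t∉good))
    }
  decided : Dec (p* ≤ p̄) → p̄ * (fromℕ (T ∸ ∣ good ∣) * D) ≤ fromℕ 2 * β * (1ℝ + fromℕ ∣ good ∣ * p*)
  decided p*≤?p̄ = begin
    p̄ * (B * D)          ≈⟨ (λ n → solve 3 (λ p b d → p :* (b :* d) := d :* (b :* p)) refl (seq p̄ n) (seq B n) (seq D n)) ⟩
    D * (B * p̄)          ≲⟨ mass-bound (<⇒≤ 0<1-exp[- 0<θ ])
      (0≤x*y (pointwise-≤ {0ℝ} {B} (λ _ → 0≤ι (T ∸ ∣ good ∣))) 0≤p̄)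
      (0≤x*y (pointwise-≤ {0ℝ} {fromℕ ∣ good ∣} (λ _ → 0≤ι ∣ good ∣)) (<⇒≤ 0<p*))
      β≤ (process-all-bound event isBad⇒event ε₁ θ X)
      (≤-trans (run-mass≤ rule ε₁ θ coins X 0<ε₁ 0<θ (proj₁ (proj₂ outcome))) (proj₂ (proj₂ outcome))) ⟩
    fromℕ 2 * β * (1ℝ + fromℕ ∣ good ∣ * p*)  ∎
    where
    open ≤-Reasoning
    B = fromℕ (T ∸ ∣ good ∣)
    -- Only the rates p* and p̄ occur, so the single decision of `p* ≤ p̄` settles the event at
    -- every index.
    rate≤? : ∀ s → Dec (rate s ≤ p̄)
    rate≤? true  = p*≤?p̄
    rate≤? false = yes ≤-refl
    low? : ∀ t → Dec (Mechanism.success (coins {Dataset} t) X ≤ p̄)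
    low? t = map′ (≤-trans (≐⇒≤ (success-coins t refl)))
      (≤-trans (≐⇒≤ (λ n → sym (success-coins t refl n)))) (rate≤? (lookup good t))
    event : Output T → Bool
    event = isLow coins low?
    isBad⇒event : ∀ o → isBad o ≡ true → event o ≡ true
    isBad⇒event (just (Sign.+ , t)) = low (lookup good t)
      where
      low : ∀ s → not s ≡ true → does (rate≤? s) ≡ true
      low false _ = refl
    outcome = rare coins admissible low?

corollary9p8 : ∀ (ε₁ ε : ℝ) → 0ℝ < ε₁ → (2ε₁<ε : fromℕ 2 * ε₁ < ε) →
    (∀ (S : Setting ε₁ ε) → let open Setting S in
    LowOutputRare →
    p̄ ≤ (fromℕ 2 * β * (1ℝ + fromℕ G * p*)) / (fromℕ (T ∸ G) * (1ℝ - exp (- θ_G ε₁ ε)))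
    [ 0<x*y 0<T-G 0<1-exp[- x<y⇒0<y-x 2ε₁<ε ] ])
    ×
    (∃ λ (C : ℝ) → ∀ (S : Setting ε₁ ε) → let open Setting S in
    LowOutputRare →
    p̄ ≤ C * ((β * (1ℝ + fromℕ G * p*)) / fromℕ (T ∸ G) [ 0<T-G ]))
corollary9p8 ε₁ ε 0<ε₁ 2ε₁<ε =
  (λ S rare → x*y≤z⇒x≤z/y _ (low-rate-bound 0<ε₁ 2ε₁<ε S rare)) ,
  fromℕ 2 * inverse D 0<D , bigO
  where
  open ≤-Reasoning
  D = 1ℝ - exp (- θ_G ε₁ ε)
  0<D : 0ℝ < D
  0<D = 0<1-exp[- x<y⇒0<y-x 2ε₁<ε ]
  bigO : (S : Setting ε₁ ε) → let open Setting S in LowOutputRare →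
    p̄ ≤ (fromℕ 2 * inverse D 0<D) * ((β * (1ℝ + fromℕ G * p*)) / fromℕ (T ∸ G) [ 0<T-G ])
  bigO S rare = begin
    p̄                                                          ≲⟨ x*y≤z⇒x≤z/y 0<T-G (x*y≤z⇒x≤z/y 0<D (≤-trans
      (≐⇒≤ (λ n → ℚₚ.*-assoc (seq p̄ n) (seq B n) (seq D n))) (low-rate-bound 0<ε₁ 2ε₁<ε S rare))) ⟩
    fromℕ 2 * β * R * inverse D 0<D * inverse B 0<T-G          ≈⟨ (λ n → solve 4
      (λ β r d b → con (ι 2) :* β :* r :* d :* b := con (ι 2) :* d :* (β :* r :* b)) refl
      (seq β n) (seq R n) (seq (inverse D 0<D) n) (seq (inverse B 0<T-G) n)) ⟩
    (fromℕ 2 * inverse D 0<D) * (β * R * inverse B 0<T-G)      ∎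
    where
    open Setting S
    B = fromℕ (T ∸ G)
    R = 1ℝ + fromℕ G * p*
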